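{- Let $T$ be a set of transpositions in the symmetric group $S_n$ such that $G_T$ is a generalized complete multipartite graph of type $k$, for some positive integer $k$. Then $\mathrm{Cay}(S_n,T)$ is integral.
   Context: $S_n$ is the symmetric group on $[n]=\{1,\dots,n\}$. For a group $G$ and an inverse-closed subset $S\subseteq G$ not containing the identity, $\mathrm{Cay}(G,S)$ is the graph with vertex set $G$ in which $g_1,g_2$ are adjacent if and only if $g_1g_2^{ -1}\in S$. For a set $T$ of transpositions in $S_n$, $G_T$ is the graph with vertex set $[n]$ in which $i,j$ are adjacent if and only if $(i,j)\in T$. A finite simple graph is integral if all eigenvalues of its adjacency matrix are integers. For a graph $G$, $G^\#$ denotes the induced subgraph of $G$ on the set of non-isolated vertices of $G$. The join $\Gamma_1*\dots*\Gamma_k$ of vertex-disjoint graphs is their disjoint union together with all edges between vertices of $\Gamma_i$ and vertices of $\Gamma_j$ for all $i\ne j$. Weak joins: let $G_1,\dots,G_k$, $k\ge 2$, be graphs with the same vertex set. A graph $G$ is a weakly join of $G_1,\dots,G_k$, written $G\in\mathcal{WJ}(G_1,\dots,G_k)$, if there exist subgraphs $\Gamma_i$ of $G_i$ ($1\le i\le k$) such that (1) $E(\Gamma_i)=E(G_i)$ for every $i$; (2) $V(\Gamma_i)\cap V(\Gamma_j)=\varnothing$ for all $i\ne j$; (3) $G^\#=\Gamma_1*\dots*\Gamma_k$. Generalized complete multipartite graphs (recursive definition): a graph $\Gamma$ is a generalized complete multipartite graph of type $1$ if $\Gamma\in\mathcal{WJ}(\Gamma_1,\dots,\Gamma_k)$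 for some graphs $\Gamma_1,\dots,\Gamma_k$ with the same vertex set, each of which is a disjoint union of complete multipartite graphs. For $m\ge 2$, $\Gamma$ is a generalized complete multipartite graph of type $m$ if $\Gamma\in\mathcal{WJ}(\Gamma_1,\dots,\Gamma_k)$ for some graphs $\Gamma_1,\dots,\Gamma_k$ with the same vertex set, each of which is a disjoint union of generalized complete multipartite graphs of type at most $m-1$. -}

module Defs where

open import Algebra.Apartness.Bundles using (HeytingField; module HeytingCommutativeRing)
open import Algebra.Bundles using (CommutativeRing; Group)
import Algebra.Definitions.RawMonoid as RawMonoidDefinitions
open import Data.Bool.Base using (if_then_else_)
open import Data.Fin.Base using (Fin; zero; suc; punchIn; combine; remQuot)
open import Data.Fin.Permutation using
  (Permutation′; _⟨$⟩ʳ_; _⟨$⟩ˡ_; _∘ₚ_; flip; inverseˡ; inverseʳ; transpose;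
   insert; remove; insert-remove)
  renaming (_≈_ to _≈ₚ_; id to idₚ)
open import Data.Fin.Permutation.Components using () renaming (transpose to swap)
open import Data.Fin.Properties using (_≟_; any?; punchIn-injective; combine-remQuot; remQuot-combine)
open import Data.Integer.Base using (ℤ; +_; -[1+_])
open import Data.Nat.Base using (ℕ; zero; suc; _≤_; _!)
open import Data.Product.Base using (Σ; ∃; ∃₂; _×_; _,_; proj₁; proj₂)
open import Data.Sum.Base using (_⊎_; inj₁; inj₂)
open import Data.Unit.Base using (tt)
open import Function.Base using (_∘_)
open import Function.Bundles using (Bijection)
open import Level using (Level; Setω; 0ℓ; _⊔_) renaming (suc to lsuc)
open import Relation.Binary.Bundles using (Setoid)
open import Relation.Binary.Core using (Rel; _⇒_; _⇔_)
import Relation.Binary.Construct.On as On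
open import Relation.Binary.Definitions using (Symmetric; _Respects_; _Respects₂_)
  renaming (Decidable to Decidable₂)
open import Relation.Binary.PropositionalEquality
  using (_≡_; _≢_; refl; sym; trans; cong; cong₂; module ≡-Reasoning)
open import Relation.Binary.PropositionalEquality.Properties using (setoid)
open import Relation.Nullary using (¬_; yes; no; does; contradiction)
open import Relation.Nullary.Decidable using (_×-dec_; _⊎-dec_; ¬?)
open import Relation.Unary using (Pred; Decidable; _⊆_; _≐_; U)
open import Relation.Unary.Properties using (U?)

private
  variable
    a c ℓ ℓ₁ ℓ₂ : Level
    n k : ℕ

-- The vertex set is a subset of an ambient setoid, so that several graphs
-- can share vertices, be subgraphs of one another, or be vertex-disjoint.
record Graph (A : Setoid c ℓ) : Set (c ⊔ ℓ ⊔ lsuc 0ℓ) where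
  open Setoid A using (Carrier; _≈_)
  infix 4 _~_
  field
    V        : Pred Carrier 0ℓ
    _~_      : Rel Carrier 0ℓ
    V?       : Decidable V
    _~?_     : Decidable₂ _~_
    V-resp   : V Respects _≈_
    ~-resp   : _~_ Respects₂ _≈_
    ~⇒V      : ∀ {x y} → x ~ y → V x
    ~-sym    : Symmetric _~_
    ~-irrefl : ∀ {x} → ¬ (x ~ x)

open Graph using (V)

Adj : {A : Setoid c ℓ} (G : Graph A) → Rel (Setoid.Carrier A) 0ℓ
Adj = Graph._~_

module _ {A : Setoid c ℓ} where

  infix 4 _≈ᴳ_ _⊆ᴳ_

  _≈ᴳ_ : Rel (Graph A) c
  G ≈ᴳ H = (V G ≐ V H) × (Adj G ⇔ Adj H)

  _⊆ᴳ_ : Rel (Graph A) c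
  G ⊆ᴳ H = (V G ⊆ V H) × (Adj G ⇒ Adj H)

  PairwiseDisjoint : (Fin k → Graph A) → Set c
  PairwiseDisjoint Γ = ∀ {i j} → i ≢ j → ∀ {x} → V (Γ i) x → ¬ V (Γ j) x

  disjointUnion : (Γ : Fin k → Graph A) → PairwiseDisjoint Γ → Graph A
  disjointUnion Γ _ = record
    { V        = λ x → ∃ λ i → V (Γ i) x
    ; _~_      = λ x y → ∃ λ i → Adj (Γ i) x y
    ; V?       = λ x → any? λ i → Graph.V? (Γ i) x
    ; _~?_     = λ x y → any? λ i → Graph._~?_ (Γ i) x y
    ; V-resp   = λ { x≈y (i , p) → i , Graph.V-resp (Γ i) x≈y p }
    ; ~-resp   = (λ { y≈z (i , e) → i , proj₁ (Graph.~-resp (Γ i)) y≈z e })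
               , (λ { y≈z (i , e) → i , proj₂ (Graph.~-resp (Γ i)) y≈z e })
    ; ~⇒V      = λ { (i , e) → i , Graph.~⇒V (Γ i) e }
    ; ~-sym    = λ { (i , e) → i , Graph.~-sym (Γ i) e }
    ; ~-irrefl = λ { (i , e) → Graph.~-irrefl (Γ i) e }
    }

  join : (Γ : Fin k → Graph A) → PairwiseDisjoint Γ → Graph A
  join Γ disjoint = record
    { V        = λ x → ∃ λ i → V (Γ i) x
    ; _~_      = λ x y → (∃ λ i → Adj (Γ i) x y)
                       ⊎ (∃₂ λ i j → i ≢ j × V (Γ i) x × V (Γ j) y)
    ; V?       = λ x → any? λ i → Graph.V? (Γ i) x
    ; _~?_     = λ x y → (any? λ i → Graph._~?_ (Γ i) x y)
                   ⊎-dec (any? λ i → any? λ j →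
                            ¬? (i ≟ j) ×-dec (Graph.V? (Γ i) x ×-dec Graph.V? (Γ j) y))
    ; V-resp   = λ { x≈y (i , p) → i , Graph.V-resp (Γ i) x≈y p }
    ; ~-resp   =
        (λ { y≈z (inj₁ (i , e)) → inj₁ (i , proj₁ (Graph.~-resp (Γ i)) y≈z e)
           ; y≈z (inj₂ (i , j , i≢j , p , q)) →
               inj₂ (i , j , i≢j , p , Graph.V-resp (Γ j) y≈z q) })
      , (λ { y≈z (inj₁ (i , e)) → inj₁ (i , proj₂ (Graph.~-resp (Γ i)) y≈z e)
           ; y≈z (inj₂ (i , j , i≢j , p , q)) →
               inj₂ (i , j , i≢j , Graph.V-resp (Γ i) y≈z p , q) })
    ; ~⇒V      = λ { (inj₁ (i , e)) → i , Graph.~⇒V (Γ i) e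
                   ; (inj₂ (i , _ , _ , p , _)) → i , p }
    ; ~-sym    = λ { (inj₁ (i , e)) → inj₁ (i , Graph.~-sym (Γ i) e)
                   ; (inj₂ (i , j , i≢j , p , q)) → inj₂ (j , i , i≢j ∘ sym , q , p) }
    ; ~-irrefl = λ { (inj₁ (i , e)) → Graph.~-irrefl (Γ i) e
                   ; (inj₂ (i , j , i≢j , p , q)) → disjoint i≢j p q }
    }

  record IsDisjointUnionOf {p} (P : Pred (Graph A) p) (G : Graph A) : Set (p ⊔ c ⊔ ℓ ⊔ lsuc 0ℓ) where
    field
      {size}     : ℕ
      components : Fin size → Graph A
      disjoint   : PairwiseDisjoint components
      isUnion    : G ≈ᴳ disjointUnion components disjoint
      satisfy    : ∀ i → P (components i)

  -- Parts may be empty, and a single part is allowed; so a one-vertex graph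
  -- is complete multipartite, as is needed for isolated vertices to be
  -- components of the disjoint unions below.
  IsCompleteMultipartite : Pred (Graph A) c
  IsCompleteMultipartite G =
    ∃ λ r → Σ (Setoid.Carrier A → Fin r) λ part →
      ∀ {x y} → V G x → V G y →
        (Adj G x y → part x ≢ part y) × (part x ≢ part y → Adj G x y)

FinGraph : ℕ → Set₁
FinGraph n = Graph (setoid (Fin n))

infix 9 _^#

_^# : FinGraph n → FinGraph n
G ^# = record
  { V        = λ x → V G x × ∃ λ y → x ~ y
  ; _~_      = _~_
  ; V?       = λ x → V? x ×-dec any? (x ~?_)
  ; _~?_     = _~?_
  ; V-resp   = λ { refl p → p }
  ; ~-resp   = ~-resp
  ; ~⇒V      = λ e → ~⇒V e , _ , e
  ; ~-sym    = ~-sym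
  ; ~-irrefl = ~-irrefl
  }
  where open Graph G hiding (V)

-- The common vertex set of the Gs need not be that of G, and a Γ i may have no
-- vertices (it has to when G has no edges, G ^# being then the null graph).
record WJ (Gs : Fin k → FinGraph n) (G : FinGraph n) : Set₁ where
  field
    2≤k          : 2 ≤ k
    sameVertices : ∀ i j → V (Gs i) ≐ V (Gs j)
    Γ            : Fin k → FinGraph n
    subgraph     : ∀ i → Γ i ⊆ᴳ Gs i
    sameEdges    : ∀ i → Adj (Γ i) ⇔ Adj (Gs i)
    disjoint     : PairwiseDisjoint Γ
    isJoin       : G ^# ≈ᴳ join Γ disjoint

data IsGCM {n} : ℕ → Pred (FinGraph n) (lsuc 0ℓ) where
  type-1   : ∀ {k G} (Gs : Fin k → FinGraph n) → WJ Gs G →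
             (∀ i → IsDisjointUnionOf IsCompleteMultipartite (Gs i)) →
             IsGCM 1 G
  type-suc : ∀ {k m G} → 1 ≤ m → (Gs : Fin k → FinGraph n) → WJ Gs G →
             (∀ i → IsDisjointUnionOf (λ H → ∃ λ l → l ≤ m × IsGCM l H) (Gs i)) →
             IsGCM (suc m) G

record ConnectionSet (𝔾 : Group c ℓ) : Set (c ⊔ ℓ ⊔ lsuc 0ℓ) where
  open Group 𝔾 using (Carrier; _≈_; ε; _⁻¹)
  field
    S         : Pred Carrier 0ℓ
    S?        : Decidable S
    S-resp    : S Respects _≈_
    S-inverse : ∀ {g} → S g → S (g ⁻¹)
    ε∉S       : ¬ S ε

Cay : (𝔾 : Group c ℓ) → ConnectionSet 𝔾 → Graph (Group.setoid 𝔾)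
Cay 𝔾 C = record
  { V        = U
  ; _~_      = λ g h → S (g ∙ h ⁻¹)
  ; V?       = U?
  ; _~?_     = λ g h → S? (g ∙ h ⁻¹)
  ; V-resp   = λ _ _ → tt
  ; ~-resp   = (λ h≈h′ → S-resp (∙-congˡ (⁻¹-cong h≈h′)))
             , (λ g≈g′ → S-resp (∙-congʳ g≈g′))
  ; ~⇒V      = λ _ → tt
  ; ~-sym    = λ {g} {h} e → S-resp
                 (G.trans (⁻¹-anti-homo-∙ g (h ⁻¹)) (∙-congʳ (⁻¹-involutive h)))
                 (S-inverse e)
  ; ~-irrefl = λ {g} e → ε∉S (S-resp (inverseʳ′ g) e)
  }
  where
  open ConnectionSet C
  open module G = Group 𝔾 using (_∙_; _⁻¹; ∙-congˡ; ∙-congʳ; ⁻¹-cong)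
    renaming (inverseʳ to inverseʳ′)
  open import Algebra.Properties.Group 𝔾 using (⁻¹-anti-homo-∙; ⁻¹-involutive)

vertexSetoid : {A : Setoid c ℓ} → Graph A → Setoid c ℓ
vertexSetoid {A = A} G = On.setoid {B = ∃ (V G)} A proj₁

record Numbering {A : Setoid c ℓ} (G : Graph A) : Set (c ⊔ ℓ) where
  field
    order     : ℕ
    bijection : Bijection (setoid (Fin order)) (vertexSetoid G)

  vertex : Fin order → Setoid.Carrier A
  vertex i = proj₁ (Bijection.to bijection i)

module _ (F : HeytingField a ℓ₁ ℓ₂) where
  open HeytingField F using (Carrier; _≈_; _#_; _*_; -_; 0#; 1#; heytingCommutativeRing)
  open CommutativeRing
    (HeytingCommutativeRing.commutativeRing heytingCommutativeRing)
    using (+-rawMonoid)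
  open RawMonoidDefinitions +-rawMonoid using (sum) renaming (_×_ to _·_)

  -- Apartness from 0# is invertibility, so this says that ℚ embeds in F.
  CharacteristicZero : Set ℓ₂
  CharacteristicZero = ∀ m → (suc m · 1#) # 0#

  fromℤ : ℤ → Carrier
  fromℤ (+ m)    = m · 1#
  fromℤ -[1+ m ] = - (suc m · 1#)

  IsEigenvalue : (Fin n → Fin n → Carrier) → Carrier → Set (a ⊔ ℓ₁)
  IsEigenvalue {n} M μ = Σ (Fin n → Carrier) λ v →
    ¬ (∀ i → v i ≈ 0#) × (∀ i → sum (λ j → M i j * v j) ≈ μ * v i)

  adjacencyMatrix : {A : Setoid c ℓ} (G : Graph A) (ν : Numbering G) →
                    Fin (Numbering.order ν) → Fin (Numbering.order ν) → Carrier
  adjacencyMatrix G ν i j = if does (vertex i ~? vertex j) then 1# else 0#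
    where
    open Graph G using (_~?_)
    open Numbering ν using (vertex)

-- In place of the eigenvalues in ℂ, the eigenvalues in every field of
-- characteristic zero are considered. A Heyting field is a constructive field:
-- classically any field, with _#_ taken as inequality. So ℂ is among them, and,
-- the matrix being rational, integrality over ℂ gives it over all the others.
Integral : {A : Setoid c ℓ} (G : Graph A) → Numbering G → Setω
Integral G ν =
  ∀ {a ℓ₁ ℓ₂} (F : HeytingField a ℓ₁ ℓ₂) → CharacteristicZero F →
  ∀ μ → IsEigenvalue F (adjacencyMatrix F G ν) μ →
  ∃ λ z → HeytingField._≈_ F μ (fromℤ F z)

Sym : ℕ → Group 0ℓ 0ℓ
Sym n = record
  { Carrier = Permutation′ n
  ; _≈_     = _≈ₚ_
  ; _∙_     = λ σ τ → τ ∘ₚ σ  -- σ after τ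
  ; ε       = idₚ
  ; _⁻¹     = flip
  ; isGroup = record
    { isMonoid = record
      { isSemigroup = record
        { isMagma = record
          { isEquivalence = record
            { refl  = λ _ → refl
            ; sym   = λ p i → sym (p i)
            ; trans = λ p q i → trans (p i) (q i)
            }
          ; ∙-cong = λ {σ} {σ′} p q i → trans (cong (σ ⟨$⟩ʳ_) (q i)) (p _)
          }
        ; assoc = λ _ _ _ _ → refl
        }
      ; identity = (λ _ _ → refl) , (λ _ _ → refl)
      }
    ; inverse = (λ σ _ → inverseˡ σ) , (λ σ _ → inverseʳ σ)
    ; ⁻¹-cong = λ {σ} {τ} p i → trans
        (sym (cong (σ ⟨$⟩ˡ_) (trans (p (τ ⟨$⟩ˡ i)) (inverseʳ τ))))
        (inverseˡ σ)
    }
  }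

IsTransposition : Pred (Permutation′ n) 0ℓ
IsTransposition π = ∃₂ λ i j → i ≢ j × π ≈ₚ transpose i j

record TranspositionSet (n : ℕ) : Set₁ where
  field
    T              : Pred (Permutation′ n) 0ℓ
    T?             : Decidable T
    T-resp         : T Respects _≈ₚ_
    transpositions : T ⊆ IsTransposition

swap-left : (i j : Fin n) → swap i j i ≡ j
swap-left i j with i ≟ i
... | yes _  = refl
... | no i≢i = contradiction refl i≢i

swap-same : (i x : Fin n) → swap i i x ≡ x
swap-same i x with x ≟ i
... | yes x≡i = sym x≡i
... | no x≢i with x ≟ i
...   | yes x≡i = sym x≡i
...   | no _    = refl

swap-comm : (i j x : Fin n) → swap i j x ≡ swap j i x
swap-comm i j x with x ≟ i in p | x ≟ j in q
... | yes x≡i | yes x≡j = trans (sym x≡j) x≡i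
... | yes _   | no _    rewrite p = refl
... | no _    | yes _   rewrite q = refl
... | no _    | no _    rewrite p | q = refl

id-not-transposition : {π : Permutation′ n} → π ≈ₚ idₚ → ¬ IsTransposition π
id-not-transposition π≈id (i , j , i≢j , π≈ij) =
  i≢j (trans (sym (π≈id i)) (trans (π≈ij i) (swap-left i j)))

transposition-inverse : {π : Permutation′ n} → IsTransposition π → π ≈ₚ flip π
transposition-inverse {π = π} (i , j , _ , π≈ij) =
  Group.trans (Sym _) {π} {transpose i j} {flip π} π≈ij
    (Group.trans (Sym _) {transpose i j} {transpose j i} {flip π} (swap-comm i j)
      (Group.sym (Sym _) {flip π} {transpose j i}
        (Group.⁻¹-cong (Sym _) {π} {transpose i j} π≈ij)))

connectionSet : TranspositionSet n → ConnectionSet (Sym n)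
connectionSet 𝕋 = record
  { S         = T
  ; S?        = T?
  ; S-resp    = λ {π} {ρ} → T-resp {π} {ρ}
  ; S-inverse = λ {π} t → T-resp (transposition-inverse {π = π} (transpositions t)) t
  ; ε∉S       = λ t → id-not-transposition {π = idₚ} (λ _ → refl) (transpositions t)
  }
  where open TranspositionSet 𝕋

transpositionGraph : TranspositionSet n → FinGraph n
transpositionGraph 𝕋 = record
  { V        = U
  ; _~_      = λ i j → T (transpose i j)
  ; V?       = U?
  ; _~?_     = λ i j → T? (transpose i j)
  ; V-resp   = λ _ _ → tt
  ; ~-resp   = (λ { refl t → t }) , (λ { refl t → t })
  ; ~⇒V      = λ _ → tt
  ; ~-sym    = λ {i} {j} → T-resp (swap-comm i j)
  ; ~-irrefl = λ {i} t → id-not-transposition {π = transpose i i} (swap-same i) (transpositions t)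
  }
  where open TranspositionSet 𝕋

-- An enumeration of the symmetric group: a permutation of 1 + n points is
-- given by the image of zero and a permutation of n points.
extend : (Fin k → Permutation′ n) → Fin (suc n) × Fin k → Permutation′ (suc n)
extend f (i , r) = insert zero i (f r)

unrank : ∀ n → Fin (n !) → Permutation′ n
unrank zero    _ = idₚ
unrank (suc n) r = extend (unrank n) (remQuot {suc n} (n !) r)

insert-injective : ∀ {i j : Fin (suc n)} (π ρ : Permutation′ n) →
                   insert zero i π ≈ₚ insert zero j ρ → i ≡ j × π ≈ₚ ρ
insert-injective {i = i} π ρ p with refl ← p zero =
  refl , λ x → punchIn-injective i _ _ (p (suc x))

insert-cong : ∀ (i : Fin (suc n)) {π ρ : Permutation′ n} →
              π ≈ₚ ρ → insert zero i π ≈ₚ insert zero i ρ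
insert-cong i p zero    = refl
insert-cong i p (suc x) = cong (punchIn i) (p x)

unrank-injective : ∀ n {r s} → unrank n r ≈ₚ unrank n s → r ≡ s
unrank-injective zero    {zero} {zero} _ = refl
unrank-injective (suc n) {r}    {s}    p
  with q , p′ ← insert-injective (unrank n _) (unrank n _) p = begin
    r                                          ≡⟨ combine-remQuot {suc n} (n !) r ⟨
    combine {suc n} (proj₁ (remQuot (n !) r)) (proj₂ (remQuot {suc n} (n !) r))
      ≡⟨ cong₂ combine q (unrank-injective n p′) ⟩
    combine {suc n} (proj₁ (remQuot (n !) s)) (proj₂ (remQuot {suc n} (n !) s))
      ≡⟨ combine-remQuot {suc n} (n !) s ⟩
    s                                          ∎
  where open ≡-Reasoning

rank : ∀ n → Permutation′ n → Fin (n !)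
rank zero    _ = zero
rank (suc n) π = combine (π ⟨$⟩ʳ zero) (rank n (remove zero π))

unrank-rank : ∀ n (π : Permutation′ n) → unrank n (rank n π) ≈ₚ π
unrank-rank (suc n) π x = begin
    extend (unrank n) (remQuot (n !) (combine i r)) ⟨$⟩ʳ x
      ≡⟨ cong (λ q → extend (unrank n) q ⟨$⟩ʳ x) (remQuot-combine i r) ⟩
    insert zero i (unrank n r) ⟨$⟩ʳ x
      ≡⟨ insert-cong i {unrank n r} {remove zero π} (unrank-rank n (remove zero π)) x ⟩
    insert zero i (remove zero π) ⟨$⟩ʳ x
      ≡⟨ insert-remove zero π x ⟩
    π ⟨$⟩ʳ x ∎
  where
  open ≡-Reasoning
  i = π ⟨$⟩ʳ zero
  r = rank n (remove zero π)

numbering : (C : ConnectionSet (Sym n)) → Numbering (Cay (Sym n) C)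
numbering {n} C = record
  { order     = n !
  ; bijection = record
    { to        = λ r → unrank n r , tt
    ; cong      = λ { refl _ → refl }
    ; bijective = (λ {r} {s} → unrank-injective n {r} {s})
                , λ { (π , _) → rank n π , λ { refl → unrank-rank n π } }
    }
  }

-- Let t(G) be the sum of the transpositions (i j) over the edges ij of G, acting on functions on
-- Sₙ; for G = G_T its matrix is the adjacency matrix of Cay(Sₙ, T). Call an operator split if a
-- product of factors e − z with z ∈ ℤ annihilates it. Sums of commuting split operators are split.
-- The complete graph is treated with Jucys–Murphy elements: t(K_W) is a sum of commuting stars
-- Σ_{y ∈ Y} (x y), and a star on Y ∪ {y} is split when the one on Y is, by the relation of the
-- degenerate affine Hecke algebra. A join with parts Vᵢ satisfies
--   t(Γ₁ * … * Γₖ) = t(K_V) + Σᵢ (t(Γᵢ) − t(K_{Vᵢ})),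
-- and all the terms commute, because a swap of two vertices of Vᵢ preserves K_V, K_{Vᵢ} and every
-- graph that avoids Vᵢ. So joins and disjoint unions preserve splitness, and a complete multipartite
-- graph is a join of edgeless graphs.
-- If t(G_T) is split, an eigenvalue μ satisfies ∏ (μ − z) v = 0, where v is not zero; since
-- distinct integers are apart in characteristic zero, cotransitivity and tightness give μ = z for
-- one of the roots.

module Submission where

open import Defs
open import Algebra.Apartness.Bundles using (HeytingField; HeytingCommutativeRing)
import Algebra.Apartness.Properties.HeytingCommutativeRing as HeytingProperties
open import Algebra.Bundles using (CommutativeRing; Ring)
import Algebra.Properties.CommutativeMonoid.Sum as CommutativeMonoidSum
import Algebra.Properties.CommutativeSemigroup as CommutativeSemigroupProperties
import Algebra.Properties.Monoid.Mult as MonoidMult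
import Algebra.Properties.Ring as RingProperties
open import Data.Bool.Base using (if_then_else_)
open import Data.Empty using (⊥)
open import Data.Fin.Base using (Fin)
open import Data.Fin.Permutation using
  (Permutation′; _⟨$⟩ʳ_; _⟨$⟩ˡ_; _∘ₚ_; flip; inverseˡ; inverseʳ; transpose)
  renaming (_≈_ to _≈ₚ_)
open import Data.Fin.Permutation.Components using (transpose-inverse) renaming (transpose to swap)
open import Data.Fin.Properties using (_≟_; any?)
open import Data.Integer.Base as ℤ using (ℤ; +_; -[1+_]) renaming (_+_ to _+ℤ_)
import Data.Integer.Properties as ℤ
open import Data.List.Base using (List; []; _∷_; _++_; map; filter; allFin; tabulate)
open import Data.List.Membership.Propositional using (_∈_)
open import Data.List.Membership.Propositional.Properties
  using (∈-map⁺; ∈-map⁻; ∈-++⁻; ∈-allFin)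
open import Data.List.Membership.Propositional.Properties.WithK using (unique∧set⇒bag)
open import Data.List.Properties using (map-∘; map-++)
open import Data.List.Relation.Binary.BagAndSetEquality using (∼bag⇒↭)
open import Data.List.Relation.Binary.Permutation.Propositional as ↭ using (_↭_; prep)
open import Data.List.Relation.Unary.All using (All; []; _∷_; lookup)
open import Data.List.Relation.Unary.AllPairs using ([]; _∷_)
open import Data.List.Relation.Unary.Any using (here; there)
open import Data.List.Relation.Unary.Unique.Propositional using (Unique)
import Data.List.Relation.Unary.Unique.Propositional.Properties as Unique
open import Data.Nat.Base as ℕ using (ℕ; zero; suc; _≤_; s≤s; _!)
import Data.Nat.Properties as ℕ
open import Data.Product.Base using (∃; ∃₂; _×_; _,_; proj₁; proj₂; uncurry)
open import Data.Sum.Base using (_⊎_; inj₁; inj₂; [_,_]′)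
open import Function.Base using (_∘_; id)
open import Function.Bundles using (mk⇔)
open import Level using (Level; _⊔_; 0ℓ)
open import Relation.Binary.Core using () renaming (_⇔_ to _⇔ᵣ_)
import Relation.Binary.PropositionalEquality as ≡
open ≡ using (_≡_; _≢_)
import Relation.Binary.Reasoning.Setoid as ≈-Reasoning
open import Relation.Nullary using (¬_; Dec; yes; no; does; contradiction)
open import Relation.Nullary.Decidable using (_⊎-dec_; _×-dec_; ¬?)
open import Relation.Unary using (Pred; Decidable; _⊆_)

open Graph using (V; V?; ~⇒V; ~-sym; ~-irrefl) renaming (_~?_ to adj?)

private
  variable
    p q : Level
    n k : ℕ
    A B : Set p
    P : Set p

-- Operators annihilated by products of integer linear factors

module Integers {c ℓ} (E : Ring c ℓ) where
  open Ring E hiding (zero)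
  open RingProperties E
  open MonoidMult +-monoid using (×-homo-+) renaming (_×_ to _·_)
  open CommutativeSemigroupProperties +-commutativeSemigroup using (interchange)
  open ≈-Reasoning setoid

  -- Taken in an arbitrary ring because it is needed both among operators and among scalars; its
  -- clauses follow those of `fromℤ`, to which it is compared at the end.
  ι : ℤ → Carrier
  ι (+ m)    = m · 1#
  ι -[1+ m ] = - (suc m · 1#)

  ι-⊖ : ∀ m n → ι (m ℤ.⊖ n) ≈ m · 1# - n · 1#
  ι-⊖ zero    zero    = sym (-‿inverseʳ 0#)
  ι-⊖ zero    (suc n) = sym (+-identityˡ _)
  ι-⊖ (suc m) zero    = sym (trans (+-congˡ -0#≈0#) (+-identityʳ _))
  ι-⊖ (suc m) (suc n) = begin
    ι (suc m ℤ.⊖ suc n)                ≡⟨ ≡.cong ι (ℤ.[1+m]⊖[1+n]≡m⊖n m n) ⟩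
    ι (m ℤ.⊖ n)                        ≈⟨ ι-⊖ m n ⟩
    m · 1# - n · 1#                    ≈⟨ +-identityˡ _ ⟨
    0# + (m · 1# - n · 1#)             ≈⟨ +-congʳ (-‿inverseʳ 1#) ⟨
    (1# - 1#) + (m · 1# - n · 1#)      ≈⟨ interchange _ _ _ _ ⟩
    (1# + m · 1#) + (- 1# - n · 1#)    ≈⟨ +-congˡ (-‿+-comm _ _) ⟩
    (1# + m · 1#) - (1# + n · 1#)      ∎

  ι-+ : ∀ z w → ι (z +ℤ w) ≈ ι z + ι w
  ι-+ (+ m)    (+ n)    = ×-homo-+ 1# m n
  ι-+ (+ m)    -[1+ n ] = ι-⊖ m (suc n)
  ι-+ -[1+ m ] (+ n)    = trans (ι-⊖ n (suc m)) (+-comm _ _)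
  ι-+ -[1+ m ] -[1+ n ] = begin
    - (suc (suc (m ℕ.+ n)) · 1#)        ≡⟨ ≡.cong (λ k → - (suc k · 1#)) (≡.sym (ℕ.+-suc m n)) ⟩
    - ((suc m ℕ.+ suc n) · 1#)          ≈⟨ -‿cong (×-homo-+ 1# (suc m) (suc n)) ⟩
    - (suc m · 1# + suc n · 1#)         ≈⟨ -‿+-comm _ _ ⟨
    - (suc m · 1#) - suc n · 1#         ∎

  ι-neg : ∀ z → ι (ℤ.- z) ≈ - ι z
  ι-neg (+ zero)  = sym -0#≈0#
  ι-neg (+ suc m) = refl
  ι-neg -[1+ m ]  = sym (-‿involutive _)

module Splitting {c ℓ} (E : Ring c ℓ) where
  open Ring E hiding (zero)
  open RingProperties E
  open MonoidMult +-monoid using () renaming (_×_ to _·_)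
  open CommutativeSemigroupProperties +-commutativeSemigroup using (interchange)
  open ≈-Reasoning setoid
  open Integers E

  Commute : Carrier → Carrier → Set ℓ
  Commute x y = x * y ≈ y * x

  private
    variable
      x y z a b e u s : Carrier

  commute-0 : Commute x 0#
  commute-0 = trans (zeroʳ _) (sym (zeroˡ _))

  commute-1 : Commute x 1#
  commute-1 = trans (*-identityʳ _) (sym (*-identityˡ _))

  commute-+ : Commute x y → Commute x z → Commute x (y + z)
  commute-+ p q = trans (distribˡ _ _ _) (trans (+-cong p q) (sym (distribʳ _ _ _)))

  commute-* : Commute x y → Commute x z → Commute x (y * z)
  commute-* {x} {y} {z} p q = begin
    x * (y * z)  ≈⟨ *-assoc x y z ⟨
    x * y * z    ≈⟨ *-congʳ p ⟩
    y * x * z    ≈⟨ *-assoc y x z ⟩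
    y * (x * z)  ≈⟨ *-congˡ q ⟩
    y * (z * x)  ≈⟨ *-assoc y z x ⟨
    y * z * x    ∎

  commute-neg : Commute x y → Commute x (- y)
  commute-neg {x} {y} p = begin
    x * - y    ≈⟨ -‿distribʳ-* x y ⟨
    - (x * y)  ≈⟨ -‿cong p ⟩
    - (y * x)  ≈⟨ -‿distribˡ-* y x ⟩
    - y * x    ∎

  commute-· : ∀ m → Commute x (m · 1#)
  commute-· zero    = commute-0
  commute-· (suc m) = commute-+ commute-1 (commute-· m)

  commute-ι : ∀ z → Commute x (ι z)
  commute-ι (+ m)    = commute-· m
  commute-ι -[1+ m ] = commute-neg (commute-· (suc m))

  commute-cong : x ≈ a → y ≈ b → Commute a b → Commute x y
  commute-cong p q r = trans (*-cong p q) (trans r (sym (*-cong q p)))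

  -- The product of the factors `e - ι z` applied to the seed `x`, the last root acting outermost.
  -- The seed lets annihilation be stated on a single element as well as on `1#`.
  prod : Carrier → List ℤ → Carrier → Carrier
  prod e []       x = x
  prod e (z ∷ zs) x = prod e zs ((e - ι z) * x)

  prod-cong : ∀ zs → a ≈ b → x ≈ y → prod a zs x ≈ prod b zs y
  prod-cong []       p q = q
  prod-cong (z ∷ zs) p q = prod-cong zs p (*-cong (+-congʳ p) q)

  prod-++ : ∀ zs ws → prod e (zs ++ ws) x ≈ prod e ws (prod e zs x)
  prod-++ []       ws = refl
  prod-++ (z ∷ zs) ws = prod-++ zs ws

  prod-*ʳ : ∀ zs → prod e zs (x * y) ≈ prod e zs x * y
  prod-*ʳ []       = refl
  prod-*ʳ (z ∷ zs) = trans (prod-cong zs refl (sym (*-assoc _ _ _))) (prod-*ʳ zs)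

  -- Integers are central, so `u` turns each factor `a - ι z` that it passes into `b - ι z`. With
  -- `a` equal to `b` this is commutation; with distinct ones it transports annihilation in
  -- `splits-hecke`.
  prod-intertwine : ∀ zs → u * a ≈ b * u → u * prod a zs x ≈ prod b zs (u * x)
  prod-intertwine []                       p = refl
  prod-intertwine {u} {a} {b} {x} (z ∷ zs) p =
    trans (prod-intertwine zs p) (prod-cong zs refl (begin
      u * ((a - ι z) * x)      ≈⟨ *-assoc _ _ _ ⟨
      u * (a - ι z) * x        ≈⟨ *-congʳ (x[y-z]≈xy-xz u a (ι z)) ⟩
      (u * a - u * ι z) * x    ≈⟨ *-congʳ (+-cong p (-‿cong (commute-ι z))) ⟩
      (b * u - ι z * u) * x    ≈⟨ *-congʳ ([y-z]x≈yx-zx u b (ι z)) ⟨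
      (b - ι z) * u * x        ≈⟨ *-assoc _ _ _ ⟩
      (b - ι z) * (u * x)      ∎))

  -- Annihilation of one element, as of a vector in the left regular module, is what the induction
  -- for sums needs: there a root is peeled off into `x`.
  SplitsOn : Carrier → Carrier → Set ℓ
  SplitsOn e x = ∃ λ zs → prod e zs x ≈ 0#

  Splits : Carrier → Set ℓ
  Splits e = SplitsOn e 1#

  splitsOn-cong : a ≈ b → x ≈ y → SplitsOn a x → SplitsOn b y
  splitsOn-cong p q (zs , eq) = zs , trans (prod-cong zs (sym p) (sym q)) eq

  commute-root : ∀ z → Commute x y → Commute x (y - ι z)
  commute-root z p = commute-+ p (commute-neg (commute-ι z))

  prod-zero : ∀ zs → Commute u e → prod e zs x ≈ 0# → prod e zs (u * x) ≈ 0#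
  prod-zero zs p eq = trans (sym (prod-intertwine zs p)) (trans (*-congˡ eq) (zeroʳ _))

  commute-prod : ∀ zs → Commute x e → Commute x (prod e zs 1#)
  commute-prod zs p = trans (prod-intertwine zs p)
    (trans (prod-cong zs refl (trans (*-identityʳ _) (sym (*-identityˡ _)))) (prod-*ʳ zs))

  prod-1 : ∀ zs → prod e zs x ≈ prod e zs 1# * x
  prod-1 zs = trans (prod-cong zs refl (sym (*-identityˡ _))) (prod-*ʳ zs)

  -- On an `x` where `a` acts as the integer `z`, the sum `a + b` acts as `z + b`. As `a` and `b`
  -- commute, applying a factor of `b` to `x` keeps this property.
  prod-shift : ∀ z ws → Commute a b → (a - ι z) * x ≈ 0# → prod b ws x ≈ 0# →
               prod (a + b) (map (z +ℤ_) ws) x ≈ 0#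
  prod-shift z [] p q r = r
  prod-shift {a} {b} {x} z (w ∷ ws) p q r = trans
    (prod-cong (map (z +ℤ_) ws) refl (begin
      (a + b - ι (z +ℤ w)) * x               ≈⟨ *-congʳ (+-congˡ (-‿cong (ι-+ z w))) ⟩
      (a + b - (ι z + ι w)) * x              ≈⟨ *-congʳ (+-congˡ (-‿+-comm _ _)) ⟨
      (a + b + (- ι z - ι w)) * x            ≈⟨ *-congʳ (interchange _ _ _ _) ⟩
      ((a - ι z) + (b - ι w)) * x            ≈⟨ distribʳ _ _ _ ⟩
      (a - ι z) * x + (b - ι w) * x          ≈⟨ +-congʳ q ⟩
      0# + (b - ι w) * x                     ≈⟨ +-identityˡ _ ⟩
      (b - ι w) * x                          ∎))
    (prod-shift z ws p (begin
      (a - ι z) * ((b - ι w) * x)  ≈⟨ *-assoc _ _ _ ⟨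
      (a - ι z) * (b - ι w) * x    ≈⟨ *-congʳ (commute-root w (sym (commute-root z (sym p)))) ⟩
      (b - ι w) * (a - ι z) * x    ≈⟨ *-assoc _ _ _ ⟩
      (b - ι w) * ((a - ι z) * x)  ≈⟨ *-congˡ q ⟩
      (b - ι w) * 0#               ≈⟨ zeroʳ _ ⟩
      0#                           ∎) r)

  -- Induction on the roots of `a`. The hypothesis for `(a - ι z) * x` gives roots `us`, and
  -- `y = prod (a + b) us x` is then killed by `a - ι z`, while `b` still splits on it with the
  -- roots `ws`; so `prod-shift` finishes with the roots `z +ℤ w`.
  splitsOn-+ : Commute a b → SplitsOn a x → SplitsOn b x → SplitsOn (a + b) x
  splitsOn-+ p ([] , eq) _ = [] , eq
  splitsOn-+ {a} {b} {x} p (z ∷ zs , eq) (ws , eq′)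
    with us , eq″ ← splitsOn-+ p (zs , eq) (ws , prod-zero ws (sym (commute-root z (sym p))) eq′)
    = us ++ map (z +ℤ_) ws , trans (prod-++ us _) (prod-shift z ws p
        (trans (prod-intertwine us (sym (commute-root z a+b-a))) eq″)
        (trans (prod-cong ws refl (prod-1 us)) (prod-zero ws (sym (commute-prod us b-a+b)) eq′)))
    where
    a+b-a : Commute (a + b) a
    a+b-a = sym (commute-+ refl p)
    b-a+b : Commute b (a + b)
    b-a+b = commute-+ (sym p) refl

  -- Each new factor is `- 1#` times an old one, and `- 1#` commutes with everything.
  splitsOn-neg : SplitsOn a x → SplitsOn (- a) x
  splitsOn-neg {a} (zs , eq) = map ℤ.-_ zs , go zs eq
    where
    go : ∀ zs {x} → prod a zs x ≈ 0# → prod (- a) (map ℤ.-_ zs) x ≈ 0#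
    go []       eq = eq
    go (z ∷ zs) {x} eq = trans (prod-cong (map ℤ.-_ zs) refl (begin
        (- a - ι (ℤ.- z)) * x   ≈⟨ *-congʳ (+-congˡ (-‿cong (ι-neg z))) ⟩
        (- a - - ι z) * x       ≈⟨ *-congʳ (-‿+-comm _ _) ⟩
        - (a - ι z) * x         ≈⟨ *-congʳ (*-identityʳ _) ⟨
        - (a - ι z) * 1# * x    ≈⟨ *-congʳ (trans (sym (-‿distribˡ-* _ _)) (-‿distribʳ-* _ _)) ⟩
        (a - ι z) * - 1# * x    ≈⟨ *-congʳ (commute-neg commute-1) ⟩
        - 1# * (a - ι z) * x    ≈⟨ *-assoc _ _ _ ⟩
        - 1# * ((a - ι z) * x)  ∎))
      (go zs (prod-zero zs (sym (commute-neg commute-1)) eq))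

  splits-0 : Splits 0#
  splits-0 = + 0 ∷ [] , trans (*-identityʳ _) (-‿inverseʳ 0#)

  -- With d = b − a and p(x) = ∏ (x − z), the element ψ = d s − 1 satisfies b ψ = ψ a, and
  -- ψ (s d − 1) = d² − 1. Hence p(b) (d² − 1) = ψ p(a) (s d − 1) = 0: applied to p(b), d splits
  -- with the roots ±1, a splits by hypothesis, and b = d + a.
  splits-hecke : Commute a b → s * s ≈ 1# → s * b ≈ 1# + a * s → Splits a → Splits b
  splits-hecke {a} {b} {s} ab ss sb (zs , eq) =
    zs ++ proj₁ b-split , trans (prod-++ zs _) (proj₂ b-split)
    where
    w d : Carrier
    w = prod b zs 1#
    d = b - a

    d+a : d + a ≈ b
    d+a = trans (+-assoc _ _ _) (trans (+-congˡ (-‿inverseˡ a)) (+-identityʳ b))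

    d-a : Commute d a
    d-a = sym (commute-+ ab (commute-neg refl))

    b-d : Commute b d
    b-d = commute-+ refl (commute-neg (sym ab))

    a-split : prod a zs w ≈ 0#
    a-split = trans (prod-1 zs) (trans (*-congʳ eq) (zeroˡ w))

    bs : b * s ≈ 1# + s * a
    bs = begin
      b * s                    ≈⟨ *-identityˡ _ ⟨
      1# * (b * s)             ≈⟨ *-congʳ ss ⟨
      s * s * (b * s)          ≈⟨ *-assoc _ _ _ ⟩
      s * (s * (b * s))        ≈⟨ *-congˡ (*-assoc _ _ _) ⟨
      s * (s * b * s)          ≈⟨ *-congˡ (*-congʳ sb) ⟩
      s * ((1# + a * s) * s)   ≈⟨ *-congˡ (distribʳ _ _ _) ⟩
      s * (1# * s + a * s * s) ≈⟨ *-congˡ (+-cong (*-identityˡ s) (*-assoc _ _ _)) ⟩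
      s * (s + a * (s * s))    ≈⟨ *-congˡ (+-congˡ (trans (*-congˡ ss) (*-identityʳ a))) ⟩
      s * (s + a)              ≈⟨ distribˡ _ _ _ ⟩
      s * s + s * a            ≈⟨ +-congʳ ss ⟩
      1# + s * a               ∎

    ψ φ : Carrier
    ψ = d * s - 1#
    φ = s * d - 1#

    x+y-y : ∀ x y → x + y - y ≈ x
    x+y-y x y = trans (+-assoc _ _ _) (trans (+-congˡ (-‿inverseʳ y)) (+-identityʳ x))

    ψ-intertwines : ψ * a ≈ b * ψ
    ψ-intertwines = begin
      (d * s - 1#) * a                ≈⟨ [y-z]x≈yx-zx _ _ _ ⟩
      d * s * a - 1# * a              ≈⟨ +-cong (*-assoc _ _ _) (-‿cong (*-identityˡ a)) ⟩
      d * (s * a) - a                 ≈⟨ +-congʳ (*-congˡ (x+y-y (s * a) 1#)) ⟨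
      d * (s * a + 1# - 1#) - a       ≈⟨ +-congʳ (*-congˡ (+-congʳ (trans (+-comm _ _) (sym bs)))) ⟩
      d * (b * s - 1#) - a            ≈⟨ +-congʳ (x[y-z]≈xy-xz _ _ _) ⟩
      d * (b * s) - d * 1# - a        ≈⟨ +-assoc _ _ _ ⟩
      d * (b * s) + (- (d * 1#) - a)  ≈⟨ +-cong (trans (sym (*-assoc _ _ _)) (*-congʳ (sym b-d)))
                                            (trans (-‿+-comm _ _) (-‿cong (trans (+-congʳ (*-identityʳ d)) d+a))) ⟩
      b * d * s - b                   ≈⟨ +-cong (*-assoc _ _ _) (-‿cong (sym (*-identityʳ b))) ⟩
      b * (d * s) - b * 1#            ≈⟨ x[y-z]≈xy-xz _ _ _ ⟨
      b * (d * s - 1#)                ∎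

    sd+ds : s * d + d * s ≈ 1# + 1#
    sd+ds = begin
      s * d + d * s                          ≈⟨ +-cong (x[y-z]≈xy-xz _ _ _) ([y-z]x≈yx-zx _ _ _) ⟩
      (s * b - s * a) + (b * s - a * s)      ≈⟨ +-cong (+-congʳ sb) (+-congʳ bs) ⟩
      (1# + a * s - s * a) + (1# + s * a - a * s)
        ≈⟨ +-cong (+-assoc _ _ _) (+-assoc _ _ _) ⟩
      (1# + (a * s - s * a)) + (1# + (s * a - a * s))
        ≈⟨ interchange _ _ _ _ ⟩
      (1# + 1#) + ((a * s - s * a) + (s * a - a * s))
        ≈⟨ +-congˡ (trans (+-congˡ (sym (⁻¹-anti-homo‿- _ _))) (-‿inverseʳ _)) ⟩
      (1# + 1#) + 0#                         ≈⟨ +-identityʳ _ ⟩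
      1# + 1#                                ∎

    ψφ : ψ * φ ≈ d * d - 1#
    ψφ = begin
      (d * s - 1#) * (s * d - 1#)                       ≈⟨ [y-z]x≈yx-zx _ _ _ ⟩
      d * s * (s * d - 1#) - 1# * (s * d - 1#)
        ≈⟨ +-cong (x[y-z]≈xy-xz _ _ _) (-‿cong (*-identityˡ _)) ⟩
      (d * s * (s * d) - d * s * 1#) - (s * d - 1#)
        ≈⟨ +-cong (+-cong dssd (-‿cong (*-identityʳ _))) (⁻¹-anti-homo‿- _ _) ⟩
      (d * d - d * s) + (1# - s * d)                    ≈⟨ interchange _ _ _ _ ⟩
      (d * d + 1#) + (- (d * s) - s * d)
        ≈⟨ +-congˡ (trans (-‿+-comm _ _) (-‿cong (trans (+-comm _ _) sd+ds))) ⟩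
      (d * d + 1#) - (1# + 1#)                          ≈⟨ +-congˡ (-‿+-comm _ _) ⟨
      (d * d + 1#) + (- 1# - 1#)                        ≈⟨ +-assoc _ _ _ ⟨
      (d * d + 1#) - 1# - 1#                            ≈⟨ +-congʳ (x+y-y _ _) ⟩
      d * d - 1#                                        ∎
      where
      dssd : d * s * (s * d) ≈ d * d
      dssd = begin
        d * s * (s * d)    ≈⟨ *-assoc _ _ _ ⟩
        d * (s * (s * d))  ≈⟨ *-congˡ (*-assoc _ _ _) ⟨
        d * (s * s * d)    ≈⟨ *-congˡ (trans (*-congʳ ss) (*-identityˡ d)) ⟩
        d * d              ∎

    factor : (d - ι -[1+ 0 ]) * (d - ι (+ 1)) ≈ d * d - 1#
    factor = begin
      (d - ι -[1+ 0 ]) * (d - ι (+ 1))   ≈⟨ *-cong (+-congˡ (trans (-‿involutive _) (+-identityʳ 1#)))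
                                              (+-congˡ (-‿cong (+-identityʳ 1#))) ⟩
      (d + 1#) * (d - 1#)                ≈⟨ x[y-z]≈xy-xz _ _ _ ⟩
      (d + 1#) * d - (d + 1#) * 1#       ≈⟨ +-cong (distribʳ _ _ _) (-‿cong (*-identityʳ _)) ⟩
      (d * d + 1# * d) - (d + 1#)        ≈⟨ +-cong (+-congˡ (*-identityˡ d)) (-‿cong (+-comm _ _)) ⟩
      (d * d + d) - (1# + d)             ≈⟨ +-congˡ (-‿anti-homo-+ _ _) ⟩
      (d * d + d) + (- d - 1#)           ≈⟨ +-assoc _ _ _ ⟨
      (d * d + d) - d - 1#               ≈⟨ +-congʳ (x+y-y _ _) ⟩
      d * d - 1#                         ∎

    d-split : SplitsOn d w
    d-split = + 1 ∷ -[1+ 0 ] ∷ [] , (begin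
      (d - ι -[1+ 0 ]) * ((d - ι (+ 1)) * w)  ≈⟨ *-assoc _ _ _ ⟨
      (d - ι -[1+ 0 ]) * (d - ι (+ 1)) * w    ≈⟨ *-congʳ (trans factor (sym ψφ)) ⟩
      -- `ψ * φ` equals `d * d - 1#`, a polynomial in `d`, which commutes with `b` and hence with
      -- `w`; so it can be moved to the right, inside `prod b zs`.
      ψ * φ * w                               ≈⟨ commute-prod zs (commute-cong ψφ refl
                                                   (sym (commute-+ (commute-* b-d b-d) (commute-neg commute-1)))) ⟩
      w * (ψ * φ)                             ≈⟨ prod-1 zs ⟨
      prod b zs (ψ * φ)                       ≈⟨ prod-*ʳ zs ⟩
      prod b zs ψ * φ                         ≈⟨ *-congʳ (prod-cong zs refl (*-identityʳ ψ)) ⟨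
      prod b zs (ψ * 1#) * φ                  ≈⟨ *-congʳ (prod-intertwine zs ψ-intertwines) ⟨
      ψ * prod a zs 1# * φ                    ≈⟨ *-congʳ (trans (*-congˡ eq) (zeroʳ ψ)) ⟩
      0# * φ                                  ≈⟨ zeroˡ φ ⟩
      0#                                      ∎)

    b-split : SplitsOn b w
    b-split = splitsOn-cong d+a refl (splitsOn-+ d-a d-split (zs , a-split))

-- Swaps, and sums over unordered pairs

swap-right : ∀ (i j : Fin n) → swap i j j ≡ i
swap-right i j = ≡.trans (swap-comm i j j) (swap-left j i)

swap-fixed : ∀ {i j k : Fin n} → k ≢ i → k ≢ j → swap i j k ≡ k
swap-fixed {i = i} {j} {k} k≢i k≢j with k ≟ i
... | yes k≡i = contradiction k≡i k≢i
... | no _ with k ≟ j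
...   | yes k≡j = contradiction k≡j k≢j
...   | no _    = ≡.refl

swap-involutive : ∀ (i j k : Fin n) → swap i j (swap i j k) ≡ k
swap-involutive i j k = ≡.trans (≡.cong (swap i j) (swap-comm i j k)) (transpose-inverse i j)

swap-injective : ∀ (i j : Fin n) {k l} → swap i j k ≡ swap i j l → k ≡ l
swap-injective i j {k} {l} eq =
  ≡.trans (≡.sym (swap-involutive i j k)) (≡.trans (≡.cong (swap i j) eq) (swap-involutive i j l))

swap-closed : ∀ (P : Pred (Fin n) p) {i j} → P i → P j → ∀ {k} → P k → P (swap i j k)
swap-closed P {i} {j} Pi Pj {k} Pk with k ≟ i
... | yes _ = Pj
... | no _ with k ≟ j
...   | yes _ = Pi
...   | no _  = Pk

swap-conj : ∀ (a b c d x : Fin n) →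
            swap a b (swap c d x) ≡ swap (swap a b c) (swap a b d) (swap a b x)
swap-conj a b c d x with x ≟ c
... | yes ≡.refl = ≡.sym (swap-left (swap a b c) (swap a b d))
... | no x≢c with x ≟ d
...   | yes ≡.refl = ≡.sym (swap-right (swap a b c) (swap a b d))
...   | no x≢d     = ≡.sym (swap-fixed (x≢c ∘ swap-injective a b) (x≢d ∘ swap-injective a b))

-- Both lists are duplicate-free and have the same members, so they agree as bags and hence up to a
-- permutation. This reindexes sums along a swap.
map-involution-↭ : ∀ {f : A → A} {xs} → (∀ x → f (f x) ≡ x) → (∀ {x} → x ∈ xs → f x ∈ xs) →
                   Unique xs → map f xs ↭ xs
map-involution-↭ {f = f} {xs} inv closed unique =
  ∼bag⇒↭ (unique∧set⇒bag (Unique.map⁺ injective unique) unique (mk⇔ to from))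
  where
  injective : ∀ {x y} → f x ≡ f y → x ≡ y
  injective {x} {y} eq = ≡.trans (≡.sym (inv x)) (≡.trans (≡.cong f eq) (inv y))

  to : ∀ {x} → x ∈ map f xs → x ∈ xs
  to x∈ with _ , y∈ , ≡.refl ← ∈-map⁻ f x∈ = closed y∈

  from : ∀ {x} → x ∈ xs → x ∈ map f xs
  from {x} x∈ = ≡.subst (_∈ map f xs) (inv x) (∈-map⁺ f (closed x∈))

-- From a duplicate-free list, every unordered pair of distinct members is obtained exactly once,
-- ordered as in the list.
pairs : List A → List (A × A)
pairs []       = []
pairs (x ∷ xs) = map (x ,_) xs ++ pairs xs

∈-pairs : ∀ {x y} (xs : List A) → (x , y) ∈ pairs xs → x ∈ xs × y ∈ xs
∈-pairs (x ∷ xs) xy∈ with ∈-++⁻ (map (x ,_) xs) xy∈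
... | inj₁ xy∈ with _ , y∈ , ≡.refl ← ∈-map⁻ (x ,_) xy∈ = here ≡.refl , there y∈
... | inj₂ xy∈ with x∈ , y∈ ← ∈-pairs xs xy∈ = there x∈ , there y∈

map-pairs : ∀ (f : A → B) xs → pairs (map f xs) ≡ map (λ (x , y) → f x , f y) (pairs xs)
map-pairs f []       = ≡.refl
map-pairs f (x ∷ xs) = ≡.trans
  (≡.cong₂ _++_ (≡.trans (≡.sym (map-∘ xs)) (map-∘ xs)) (map-pairs f xs))
  (≡.sym (map-++ _ (map (x ,_) xs) (pairs xs)))

-- Finite sums in a ring.

module Sums {c ℓ} (E : Ring c ℓ) where
  open Ring E hiding (zero)
  open Splitting E
  open CommutativeSemigroupProperties +-commutativeSemigroup using (interchange; x∙yz≈y∙xz)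
  open ≈-Reasoning setoid

  ∑ : List A → (A → Carrier) → Carrier
  ∑ []       f = 0#
  ∑ (x ∷ xs) f = f x + ∑ xs f

  module _ {A : Set p} where

    ∑-cong : ∀ xs {f g : A → Carrier} → (∀ {x} → x ∈ xs → f x ≈ g x) → ∑ xs f ≈ ∑ xs g
    ∑-cong []       eq = refl
    ∑-cong (x ∷ xs) eq = +-cong (eq (here ≡.refl)) (∑-cong xs (eq ∘ there))

    ∑-zero : ∀ xs {f : A → Carrier} → (∀ {x} → x ∈ xs → f x ≈ 0#) → ∑ xs f ≈ 0#
    ∑-zero []       eq = refl
    ∑-zero (x ∷ xs) eq = trans (+-cong (eq (here ≡.refl)) (∑-zero xs (eq ∘ there))) (+-identityˡ 0#)

    ∑-single : ∀ {xs a} (f : A → Carrier) → Unique xs → a ∈ xs → (∀ {x} → x ≢ a → f x ≈ 0#) →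
               ∑ xs f ≈ f a
    ∑-single f (a# ∷ _) (here ≡.refl) vanish = trans
      (+-congˡ (∑-zero _ λ x∈ → vanish (lookup a# x∈ ∘ ≡.sym))) (+-identityʳ _)
    ∑-single f (x# ∷ u) (there a∈)    vanish = trans
      (+-cong (vanish (lookup x# a∈)) (∑-single f u a∈ vanish)) (+-identityˡ _)

    ∑-+ : ∀ xs (f g : A → Carrier) → ∑ xs (λ x → f x + g x) ≈ ∑ xs f + ∑ xs g
    ∑-+ []       f g = sym (+-identityˡ 0#)
    ∑-+ (x ∷ xs) f g = trans (+-congˡ (∑-+ xs f g)) (interchange _ _ _ _)

    ∑-*ˡ : ∀ xs (f : A → Carrier) y → y * ∑ xs f ≈ ∑ xs (λ x → y * f x)
    ∑-*ˡ []       f y = zeroʳ y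
    ∑-*ˡ (x ∷ xs) f y = trans (distribˡ y _ _) (+-congˡ (∑-*ˡ xs f y))

    ∑-*ʳ : ∀ xs (f : A → Carrier) y → ∑ xs f * y ≈ ∑ xs (λ x → f x * y)
    ∑-*ʳ []       f y = zeroˡ y
    ∑-*ʳ (x ∷ xs) f y = trans (distribʳ y _ _) (+-congˡ (∑-*ʳ xs f y))

    ∑-++ : ∀ xs ys (f : A → Carrier) → ∑ (xs ++ ys) f ≈ ∑ xs f + ∑ ys f
    ∑-++ []       ys f = sym (+-identityˡ _)
    ∑-++ (x ∷ xs) ys f = trans (+-congˡ (∑-++ xs ys f)) (sym (+-assoc _ _ _))

    ∑-map : ∀ {B : Set q} (h : B → A) xs (f : A → Carrier) → ∑ (map h xs) f ≡ ∑ xs (f ∘ h)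
    ∑-map h []       f = ≡.refl
    ∑-map h (x ∷ xs) f = ≡.cong (λ y → f (h x) + y) (∑-map h xs f)

    ∑-↭ : ∀ {xs ys} (f : A → Carrier) → xs ↭ ys → ∑ xs f ≈ ∑ ys f
    ∑-↭ f ↭.refl         = refl
    ∑-↭ f (prep x r)   = +-congˡ (∑-↭ f r)
    ∑-↭ f (↭.swap x y r) = trans (+-congˡ (+-congˡ (∑-↭ f r))) (x∙yz≈y∙xz _ _ _)
    ∑-↭ f (↭.trans r r′) = trans (∑-↭ f r) (∑-↭ f r′)

    commute-∑ : ∀ {e} xs {f : A → Carrier} → (∀ {x} → x ∈ xs → Commute e (f x)) → Commute e (∑ xs f)
    commute-∑ []       eq = commute-0
    commute-∑ (x ∷ xs) eq = commute-+ (eq (here ≡.refl)) (commute-∑ xs (eq ∘ there))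

    splits-∑ : ∀ xs {f : A → Carrier} → (∀ x y → Commute (f x) (f y)) → (∀ x → Splits (f x)) →
                 Splits (∑ xs f)
    splits-∑ []       comm int = splits-0
    splits-∑ (x ∷ xs) comm int =
      splitsOn-+ (commute-∑ xs (λ {y} _ → comm x y)) (int x) (splits-∑ xs comm int)

  ∑-comm : ∀ {A : Set p} {B : Set q} xs ys (f : A → B → Carrier) →
           ∑ xs (λ x → ∑ ys (f x)) ≈ ∑ ys (λ y → ∑ xs (λ x → f x y))
  ∑-comm []       ys f = sym (∑-zero ys λ _ → refl)
  ∑-comm (x ∷ xs) ys f = trans (+-congˡ (∑-comm xs ys f)) (sym (∑-+ ys (f x) _))

  module _ {A : Set p} (f : A × A → Carrier) where

    ∑-pairs-∷ : ∀ x xs → ∑ (pairs (x ∷ xs)) f ≈ ∑ xs (λ y → f (x , y)) + ∑ (pairs xs) f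
    ∑-pairs-∷ x xs = trans (∑-++ (map (x ,_) xs) (pairs xs) f)
      (+-congʳ (reflexive (∑-map (x ,_) xs f)))

    -- Reordering a list can turn a listed pair `(x , y)` into `(y , x)`; symmetry of `f` absorbs
    -- this, and everything else is a rearrangement of the summands.
    ∑-pairs-↭ : (∀ x y → f (x , y) ≈ f (y , x)) →
                ∀ {xs ys} → xs ↭ ys → ∑ (pairs xs) f ≈ ∑ (pairs ys) f
    ∑-pairs-↭ f-sym ↭.refl = refl
    ∑-pairs-↭ f-sym (prep {xs} {ys} x r) = begin
      ∑ (pairs (x ∷ xs)) f                          ≈⟨ ∑-pairs-∷ x xs ⟩
      ∑ xs (λ y → f (x , y)) + ∑ (pairs xs) f       ≈⟨ +-cong (∑-↭ _ r) (∑-pairs-↭ f-sym r) ⟩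
      ∑ ys (λ y → f (x , y)) + ∑ (pairs ys) f       ≈⟨ ∑-pairs-∷ x ys ⟨
      ∑ (pairs (x ∷ ys)) f                          ∎
    ∑-pairs-↭ f-sym (↭.swap {xs} {ys} x y r) = begin
      ∑ (pairs (x ∷ y ∷ xs)) f                      ≈⟨ two x y xs ⟩
      f (x , y) + (∑ xs (λ z → f (x , z)) + (∑ xs (λ z → f (y , z)) + ∑ (pairs xs) f))
        ≈⟨ +-cong (f-sym x y) (x∙yz≈y∙xz _ _ _) ⟩
      f (y , x) + (∑ xs (λ z → f (y , z)) + (∑ xs (λ z → f (x , z)) + ∑ (pairs xs) f))
        ≈⟨ +-congˡ (+-cong (∑-↭ _ r) (+-cong (∑-↭ _ r) (∑-pairs-↭ f-sym r))) ⟩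
      f (y , x) + (∑ ys (λ z → f (y , z)) + (∑ ys (λ z → f (x , z)) + ∑ (pairs ys) f))
        ≈⟨ two y x ys ⟨
      ∑ (pairs (y ∷ x ∷ ys)) f                      ∎
      where
      two : ∀ x y xs → ∑ (pairs (x ∷ y ∷ xs)) f ≈
            f (x , y) + (∑ xs (λ z → f (x , z)) + (∑ xs (λ z → f (y , z)) + ∑ (pairs xs) f))
      two x y xs = trans (∑-pairs-∷ x (y ∷ xs)) (trans (+-congˡ (∑-pairs-∷ y xs)) (+-assoc _ _ _))
    ∑-pairs-↭ f-sym (↭.trans r r′) = trans (∑-pairs-↭ f-sym r) (∑-pairs-↭ f-sym r′)

    -- Exactly one of `(a , b)` and `(b , a)` is listed, depending on which comes first in `xs`;
    -- `head` treats the position where the earlier of the two stands at the front, with either one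
    -- in the role of `c`.
    ∑-pairs-single : (∀ x y → f (x , y) ≈ f (y , x)) →
      ∀ {xs a b} → Unique xs → a ≢ b → a ∈ xs → b ∈ xs →
      (∀ {x y} → ¬ (x ≡ a × y ≡ b) → ¬ (x ≡ b × y ≡ a) → f (x , y) ≈ 0#) →
      ∑ (pairs xs) f ≈ f (a , b)
    ∑-pairs-single f-sym {a = a} {b} unique a≢b a∈ b∈ vanish = go unique a∈ b∈
      where
      head : ∀ {c d xs} → Unique (c ∷ xs) → d ∈ xs → c ≢ d →
             (∀ {x y} → ¬ (x ≡ c × y ≡ d) → ¬ (x ≡ d × y ≡ c) → f (x , y) ≈ 0#) →
             ∑ (pairs (c ∷ xs)) f ≈ f (c , d)
      head {c} {d} {xs} (c# ∷ unique) d∈ c≢d vanish = begin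
        ∑ (pairs (c ∷ xs)) f                            ≈⟨ ∑-pairs-∷ c xs ⟩
        ∑ xs (λ y → f (c , y)) + ∑ (pairs xs) f
          ≈⟨ +-cong (∑-single _ unique d∈ λ y≢d → vanish (y≢d ∘ proj₂) (c≢d ∘ proj₁))
                    (∑-zero (pairs xs) λ xy∈ → let x∈ , y∈ = ∈-pairs xs xy∈ in
                      vanish (λ eq → lookup c# x∈ (≡.sym (proj₁ eq)))
                             (λ eq → lookup c# y∈ (≡.sym (proj₂ eq)))) ⟩
        f (c , d) + 0#                                  ≈⟨ +-identityʳ _ ⟩
        f (c , d)                                       ∎

      go : ∀ {xs} → Unique xs → a ∈ xs → b ∈ xs → ∑ (pairs xs) f ≈ f (a , b)
      go u (here ≡.refl) (here ≡.refl) = contradiction ≡.refl a≢b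
      go u (here ≡.refl) (there b∈)    = head u b∈ a≢b vanish
      go u (there a∈)    (here ≡.refl) =
        trans (head u a∈ (a≢b ∘ ≡.sym) λ p q → vanish q p) (f-sym b a)
      go {x ∷ xs} (x# ∷ u) (there a∈) (there b∈) = begin
        ∑ (pairs (x ∷ xs)) f                            ≈⟨ ∑-pairs-∷ x xs ⟩
        ∑ xs (λ y → f (x , y)) + ∑ (pairs xs) f
          ≈⟨ +-cong (∑-zero xs λ _ → vanish (lookup x# a∈ ∘ proj₁) (lookup x# b∈ ∘ proj₁)) (go u a∈ b∈) ⟩
        0# + f (a , b)                                  ≈⟨ +-identityˡ _ ⟩
        f (a , b)                                       ∎

  infix 5 _when_

  -- Branches on `does`, like the entries of `adjacencyMatrix`, so that these are literally
  -- `1# when` their adjacency test.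
  _when_ : Carrier → Dec P → Carrier
  e when d = if does d then e else 0#

  module _ (e : Carrier) where

    when-yes : ∀ {P : Set p} (P? : Dec P) → P → e when P? ≈ e
    when-yes (yes _) _ = refl
    when-yes (no ¬p) p = contradiction p ¬p

    when-no : ∀ {P : Set p} (P? : Dec P) → ¬ P → e when P? ≈ 0#
    when-no (yes p) ¬p = contradiction p ¬p
    when-no (no _)  _  = refl

    when-⇔ : ∀ {P : Set p} {Q : Set q} (P? : Dec P) (Q? : Dec Q) → (P → Q) → (Q → P) →
             e when P? ≈ e when Q?
    when-⇔ (yes p) Q? f g = sym (when-yes Q? (f p))
    when-⇔ (no ¬p) Q? f g = sym (when-no Q? (¬p ∘ g))

    when-⊎ : ∀ {P : Set p} {Q : Set q} (P? : Dec P) (Q? : Dec Q) → (P → ¬ Q) →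
             e when (P? ⊎-dec Q?) ≈ (e when P?) + (e when Q?)
    when-⊎ (yes p) (yes q) excl = contradiction q (excl p)
    when-⊎ (yes p) (no _)  excl = sym (+-identityʳ e)
    when-⊎ (no _)  (yes _) excl = sym (+-identityˡ e)
    when-⊎ (no _)  (no _)  excl = sym (+-identityˡ 0#)

    ∑-when-∃ : ∀ {k} {P : Pred (Fin k) p} (P? : Decidable P) → (∀ {i j} → i ≢ j → P i → ¬ P j) →
               ∑ (allFin k) (λ i → e when P? i) ≈ e when any? P?
    ∑-when-∃ {k = k} P? excl with any? P?
    ... | yes (i , Pi) = trans
            (∑-single _ (Unique.allFin⁺ k) (∈-allFin i) (λ {j} j≢i → when-no (P? j) λ Pj → excl j≢i Pj Pi))
            (when-yes (P? i) Pi)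
    ... | no ∄i = ∑-zero (allFin k) λ {i} _ → when-no (P? i) (λ Pi → ∄i (i , Pi))

  when-cong : ∀ {e e′} (P? : Dec P) → e ≈ e′ → e when P? ≈ e′ when P?
  when-cong (yes _) eq = eq
  when-cong (no _)  eq = refl

  when-*ˡ : ∀ x {e} (P? : Dec P) → x * (e when P?) ≈ (x * e when P?)
  when-*ˡ x (yes _) = refl
  when-*ˡ x (no _)  = zeroʳ x

  when-*ʳ : ∀ x {e} (P? : Dec P) → (e when P?) * x ≈ (e * x when P?)
  when-*ʳ x (yes _) = refl
  when-*ʳ x (no _)  = zeroˡ x

  ∑-filter : ∀ {P : Pred A p} (P? : Decidable P) xs (f : A → Carrier) →
             ∑ (filter P? xs) f ≈ ∑ xs (λ x → f x when P? x)
  ∑-filter P? []       f = refl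
  ∑-filter P? (x ∷ xs) f with P? x
  ... | yes _ = +-congˡ (∑-filter P? xs f)
  ... | no _  = trans (∑-filter P? xs f) (sym (+-identityˡ _))

-- Sums of transpositions over the edges of a graph

completeGraph : (W : Pred (Fin n) 0ℓ) → Decidable W → FinGraph n
completeGraph W W? = record
  { V        = W
  ; _~_      = λ x y → x ≢ y × W x × W y
  ; V?       = W?
  ; _~?_     = λ x y → ¬? (x ≟ y) ×-dec (W? x ×-dec W? y)
  ; V-resp   = λ { ≡.refl p → p }
  ; ~-resp   = (λ { ≡.refl e → e }) , (λ { ≡.refl e → e })
  ; ~⇒V      = λ (_ , p , _) → p
  ; ~-sym    = λ (x≢y , p , q) → x≢y ∘ ≡.sym , q , p
  ; ~-irrefl = λ (x≢x , _) → x≢x ≡.refl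
  }

edgelessGraph : (W : Pred (Fin n) 0ℓ) → Decidable W → FinGraph n
edgelessGraph W W? = record
  { V        = W
  ; _~_      = λ _ _ → ⊥
  ; V?       = W?
  ; _~?_     = λ _ _ → no λ ()
  ; V-resp   = λ { ≡.refl p → p }
  ; ~-resp   = (λ { ≡.refl e → e }) , (λ { ≡.refl e → e })
  ; ~⇒V      = λ ()
  ; ~-sym    = λ ()
  ; ~-irrefl = λ ()
  }

clique : FinGraph n → FinGraph n
clique G = completeGraph (V G) (V? G)

-- The relations among transpositions from which splitness follows, in any ring; `s-conj` is
-- conjugation written without inverses.
record Transpositions {c ℓ} (E : Ring c ℓ) (n : ℕ) : Set (c ⊔ ℓ) where
  open Ring E hiding (zero)
  field
    s        : Fin n → Fin n → Carrier
    s-sym    : ∀ i j → s i j ≈ s j i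
    s-square : ∀ i j → s i j * s i j ≈ 1#
    s-conj   : ∀ a b c d → s a b * s c d ≈ s (swap a b c) (swap a b d) * s a b

module GraphElements {c ℓ} {E : Ring c ℓ} (S : Transpositions E n) where
  open Ring E hiding (zero)
  open RingProperties E using (+-cancelʳ)
  open Transpositions S
  open Splitting E
  open Sums E
  open ≈-Reasoning setoid

  -- The Jucys–Murphy element when x is the successor of ys = 1, …, x − 1.
  star : Fin n → List (Fin n) → Carrier
  star x ys = ∑ ys (s x)

  -- A swap of two members of `ys` fixes `x` and permutes `ys`, so conjugation by `s a b` only
  -- reorders the summands.
  commute-star : ∀ {a b x ys} → Unique ys → a ∈ ys → b ∈ ys → (∀ {y} → y ∈ ys → x ≢ y) →
                 Commute (s a b) (star x ys)
  commute-star {a} {b} {x} {ys} unique a∈ b∈ x∉ = begin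
    s a b * ∑ ys (s x)                              ≈⟨ ∑-*ˡ ys (s x) (s a b) ⟩
    ∑ ys (λ y → s a b * s x y)                      ≈⟨ ∑-cong ys (λ {y} _ → s-conj a b x y) ⟩
    ∑ ys (λ y → s (σ x) (σ y) * s a b)              ≈⟨ ∑-*ʳ ys (λ y → s (σ x) (σ y)) (s a b) ⟨
    ∑ ys (λ y → s (σ x) (σ y)) * s a b
      ≡⟨ ≡.cong (λ z → ∑ ys (λ y → s z (σ y)) * s a b) (swap-fixed (x∉ a∈) (x∉ b∈)) ⟩
    ∑ ys (λ y → s x (σ y)) * s a b                  ≡⟨ ≡.cong (_* s a b) (∑-map σ ys (s x)) ⟨
    ∑ (map σ ys) (s x) * s a b
      ≈⟨ *-congʳ (∑-↭ (s x) (map-involution-↭ (swap-involutive a b) (swap-closed (_∈ ys) a∈ b∈) unique)) ⟩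
    ∑ ys (s x) * s a b                              ∎
    where
    σ : Fin n → Fin n
    σ = swap a b

  -- Conjugation by `s x y` moves the centre: it turns every `s x z` into `s y z`. Hence
  -- `splits-hecke` applies with `star y ys` as `a`, split by induction, `star x (y ∷ ys)` as `b`,
  -- and `s x y` as `s`. The two stars commute because each `s y z` swaps two ends of the bigger
  -- one.
  splits-star : ∀ {x ys} → Unique (x ∷ ys) → Splits (star x ys)
  splits-star {x} {[]}     _ = splits-0
  splits-star {x} {y ∷ ys} (x# ∷ y# ∷ u) =
    splits-hecke
      (sym (commute-∑ ys λ z∈ → sym (commute-star (y# ∷ u) (here ≡.refl) (there z∈) (lookup x#))))
      (s-square x y)
      (begin
        s x y * (s x y + ∑ ys (s x))                ≈⟨ distribˡ _ _ _ ⟩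
        s x y * s x y + s x y * ∑ ys (s x)          ≈⟨ +-cong (s-square x y) (∑-*ˡ ys (s x) (s x y)) ⟩
        1# + ∑ ys (λ z → s x y * s x z)             ≈⟨ +-congˡ (∑-cong ys λ {z} z∈ →
          trans (s-conj x y x z) (*-congʳ (reflexive (≡.cong₂ s (swap-left x y)
            (swap-fixed (lookup x# (there z∈) ∘ ≡.sym) (lookup y# z∈ ∘ ≡.sym)))))) ⟩
        1# + ∑ ys (λ z → s y z * s x y)             ≈⟨ +-congˡ (∑-*ʳ ys (s y) (s x y)) ⟨
        1# + ∑ ys (s y) * s x y                     ∎)
      (splits-star (y# ∷ u))

  -- The pairs with `x` form a star, which commutes with every transposition of two of the remaining
  -- points.
  splits-pairs : ∀ {xs} → Unique xs → Splits (∑ (pairs xs) (uncurry s))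
  splits-pairs {[]}     _ = splits-0
  splits-pairs {x ∷ xs} (x# ∷ u) = splitsOn-cong (sym (∑-pairs-∷ (uncurry s) x xs)) refl
    (splitsOn-+
      (commute-∑ (pairs xs) λ ij∈ → let i∈ , j∈ = ∈-pairs xs ij∈ in
        sym (commute-star u i∈ j∈ (lookup x#)))
      (splits-star (x# ∷ u)) (splits-pairs u))

  t : FinGraph n → Carrier
  t G = ∑ (pairs (allFin n)) (λ (i , j) → s i j when adj? G i j)

  t-cong : ∀ G H → Adj G ⇔ᵣ Adj H → t G ≈ t H
  t-cong G H (f , g) =
    ∑-cong (pairs (allFin n)) λ { {i , j} _ → when-⇔ (s i j) (adj? G i j) (adj? H i j) f g }

  -- If the swap along every edge of `H` is an automorphism of `G`, conjugation by it permutes the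
  -- edges of `G` and so fixes `t G`; hence each summand of `t H` commutes with `t G`.
  commute-t : ∀ H G →
    (∀ {i j} → Adj H i j → ∀ {k l} → Adj G k l → Adj G (swap i j k) (swap i j l)) →
    Commute (t H) (t G)
  commute-t H G preserves = sym (commute-∑ (pairs (allFin n)) λ { {i , j} _ → edge i j (adj? H i j) })
    where
    F : Fin n × Fin n → Carrier
    F (k , l) = s k l when adj? G k l

    F-sym : ∀ k l → F (k , l) ≈ F (l , k)
    F-sym k l = trans (when-cong (adj? G k l) (s-sym k l))
      (when-⇔ (s l k) (adj? G k l) (adj? G l k) (~-sym G) (~-sym G))

    edge : ∀ i j → (d : Dec (Adj H i j)) → Commute (t G) (s i j when d)
    edge i j (no _)  = commute-0
    edge i j (yes e) = sym (begin
      s i j * t G                                             ≈⟨ ∑-*ˡ (pairs (allFin n)) F (s i j) ⟩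
      ∑ (pairs (allFin n)) (λ kl → s i j * F kl)              ≈⟨ ∑-cong (pairs (allFin n)) (λ _ → conj _) ⟩
      ∑ (pairs (allFin n)) (λ (k , l) → F (σ k , σ l) * s i j)  ≈⟨ ∑-*ʳ (pairs (allFin n)) _ (s i j) ⟨
      ∑ (pairs (allFin n)) (λ (k , l) → F (σ k , σ l)) * s i j
        ≡⟨ ≡.cong (_* s i j) (∑-map _ (pairs (allFin n)) F) ⟨
      ∑ (map (λ (k , l) → σ k , σ l) (pairs (allFin n))) F * s i j
        ≡⟨ ≡.cong (λ xs → ∑ xs F * s i j) (map-pairs σ (allFin n)) ⟨
      ∑ (pairs (map σ (allFin n))) F * s i j
        ≈⟨ *-congʳ (∑-pairs-↭ F F-sym
             (map-involution-↭ (swap-involutive i j) (λ _ → ∈-allFin _) (Unique.allFin⁺ n))) ⟩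
      t G * s i j                                             ∎)
      where
      σ : Fin n → Fin n
      σ = swap i j

      -- A swap is its own inverse, so preserving adjacency implies reflecting it.
      reflects : ∀ {k l} → Adj G (σ k) (σ l) → Adj G k l
      reflects {k} {l} a = ≡.subst₂ (Adj G) (swap-involutive i j k) (swap-involutive i j l) (preserves e a)

      conj : ∀ kl → s i j * F kl ≈ F (σ (proj₁ kl) , σ (proj₂ kl)) * s i j
      conj (k , l) = begin
        s i j * (s k l when adj? G k l)                     ≈⟨ when-*ˡ (s i j) (adj? G k l) ⟩
        (s i j * s k l when adj? G k l)                     ≈⟨ when-cong (adj? G k l) (s-conj i j k l) ⟩
        (s (σ k) (σ l) * s i j when adj? G k l)
          ≈⟨ when-⇔ _ (adj? G k l) (adj? G (σ k) (σ l)) (preserves e) reflects ⟩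
        (s (σ k) (σ l) * s i j when adj? G (σ k) (σ l))     ≈⟨ when-*ʳ (s i j) (adj? G (σ k) (σ l)) ⟨
        (s (σ k) (σ l) when adj? G (σ k) (σ l)) * s i j     ∎

  -- Swaps along edges of `H` fix every vertex of `G`.
  commute-disjoint : ∀ H G → (∀ {x} → V H x → ¬ V G x) → Commute (t H) (t G)
  commute-disjoint H G disjoint = commute-t H G λ {i} {j} ij {k} {l} kl →
    let fixed : ∀ {x} → V G x → swap i j x ≡ x
        fixed {x} Gx = swap-fixed {i = i} {j} {x}
          (λ { ≡.refl → disjoint (~⇒V H ij) Gx }) (λ { ≡.refl → disjoint (~⇒V H (~-sym H ij)) Gx })
    in ≡.subst₂ (Adj G) (≡.sym (fixed (~⇒V G kl))) (≡.sym (fixed (~⇒V G (~-sym G kl)))) kl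

  -- A swap of two members of `W` maps `W` into itself, so it is an automorphism of the complete
  -- graph.
  commute-complete : ∀ H {W : Pred (Fin n) 0ℓ} (W? : Decidable W) → V H ⊆ W →
                     Commute (t H) (t (completeGraph W W?))
  commute-complete H {W} W? H⊆W = commute-t H (completeGraph W W?) λ {i} {j} ij (k≢l , Wk , Wl) →
    let closed = swap-closed W {i} {j} (H⊆W (~⇒V H ij)) (H⊆W (~⇒V H (~-sym H ij)))
    in k≢l ∘ swap-injective i j , closed Wk , closed Wl

  splits-complete : ∀ {W : Pred (Fin n) 0ℓ} (W? : Decidable W) → Splits (t (completeGraph W W?))
  splits-complete {W} W? = splitsOn-cong (sym (restrict (Unique.allFin⁺ n))) refl
    (splits-pairs (Unique.filter⁺ W? (Unique.allFin⁺ n)))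
    where
    K = completeGraph W W?

    -- Proved for every duplicate-free list, to allow induction: the pairs with an endpoint outside
    -- `W` contribute zero, and the others are the pairs of the filtered list.
    restrict : ∀ {xs} → Unique xs →
      ∑ (pairs xs) (λ (i , j) → s i j when adj? K i j) ≈ ∑ (pairs (filter W? xs)) (uncurry s)
    restrict {[]}     _ = refl
    restrict {x ∷ xs} (x# ∷ u) with W? x in eq
    ... | no ¬Wx = trans (∑-pairs-∷ _ x xs) (trans
          (+-cong (∑-zero xs λ {y} _ → when-no (s x y) (adj? K x y) (¬Wx ∘ proj₁ ∘ proj₂)) (restrict u))
          (+-identityˡ _))
    ... | yes Wx = trans (∑-pairs-∷ _ x xs) (trans
          (+-cong (trans
              (∑-cong xs λ {y} y∈ → when-⇔ (s x y) (adj? K x y) (W? y)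
                (proj₂ ∘ proj₂) (λ Wy → lookup x# y∈ , Wx , Wy))
              (sym (∑-filter W? xs (s x))))
            (restrict u))
          (sym (∑-pairs-∷ _ x (filter W? xs))))

  t-disjointUnion : ∀ (Γ : Fin k → FinGraph n) (disjoint : PairwiseDisjoint Γ) →
                    t (disjointUnion Γ disjoint) ≈ ∑ (allFin k) (λ i → t (Γ i))
  t-disjointUnion {k = k} Γ disjoint = trans
    (∑-cong (pairs (allFin n)) λ { {x , y} _ → sym (∑-when-∃ (s x y) (λ i → adj? (Γ i) x y)
      λ {i} {j} i≢j e e′ → disjoint i≢j (~⇒V (Γ i) e) (~⇒V (Γ j) e′)) })
    (∑-comm (pairs (allFin n)) (allFin k) _)

  splits-disjointUnion : ∀ (Γ : Fin k → FinGraph n) (disjoint : PairwiseDisjoint Γ) →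
    (∀ i → Splits (t (Γ i))) → Splits (t (disjointUnion Γ disjoint))
  splits-disjointUnion {k = k} Γ disjoint splits =
    splitsOn-cong (sym (t-disjointUnion Γ disjoint)) refl (splits-∑ (allFin k) comm splits)
    where
    comm : ∀ i j → Commute (t (Γ i)) (t (Γ j))
    comm i j with i ≟ j
    ... | yes ≡.refl = refl
    ... | no i≢j     = commute-disjoint (Γ i) (Γ j) (disjoint i≢j)

  module _ (Γ : Fin k → FinGraph n) (disjoint : PairwiseDisjoint Γ) where

    private
      W : Pred (Fin n) 0ℓ
      W x = ∃ λ i → V (Γ i) x

      W? : Decidable W
      W? x = any? λ i → V? (Γ i) x

      same-index : ∀ {i j x} → V (Γ i) x → V (Γ j) x → i ≡ j
      same-index {i} {j} p q with i ≟ j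
      ... | yes i≡j = i≡j
      ... | no i≢j  = contradiction q (disjoint i≢j p)

    -- Two distinct vertices of W either lie in one part or lie in two parts and are joined.
    t-join : t (join Γ disjoint) + t (disjointUnion (clique ∘ Γ) disjoint) ≈
             t (disjointUnion Γ disjoint) + t (completeGraph W W?)
    t-join = trans (sym (∑-+ (pairs (allFin n)) _ _)) (trans
      (∑-cong (pairs (allFin n)) λ { {x , y} _ → pointwise x y })
      (∑-+ (pairs (allFin n)) _ _))
      where
      pointwise : ∀ x y →
        (s x y when adj? (join Γ disjoint) x y) +
        (s x y when adj? (disjointUnion (clique ∘ Γ) disjoint) x y) ≈
        (s x y when adj? (disjointUnion Γ disjoint) x y) +
        (s x y when adj? (completeGraph W W?) x y)
      pointwise x y = begin
        (e when (union? ⊎-dec across?)) + (e when same?)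
          ≈⟨ +-congʳ (when-⊎ e union? across? λ { (i , xy) (j , k , j≢k , p , q) →
               j≢k (≡.trans (same-index p (~⇒V (Γ i) xy))
                            (same-index (~⇒V (Γ i) (~-sym (Γ i) xy)) q)) }) ⟩
        (e when union?) + (e when across?) + (e when same?)    ≈⟨ +-assoc _ _ _ ⟩
        (e when union?) + ((e when across?) + (e when same?))
          ≈⟨ +-congˡ (when-⊎ e across? same? λ { (j , k , j≢k , p , q) (i , _ , p′ , q′) →
               j≢k (≡.trans (same-index p p′) (same-index q′ q)) }) ⟨
        (e when union?) + (e when (across? ⊎-dec same?))
          ≈⟨ +-congˡ (when-⇔ e (across? ⊎-dec same?) (adj? (completeGraph W W?) x y) to from) ⟩
        (e when union?) + (e when adj? (completeGraph W W?) x y)   ∎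
        where
        e = s x y
        union? = adj? (disjointUnion Γ disjoint) x y
        same?  = adj? (disjointUnion (clique ∘ Γ) disjoint) x y

        Across : Set
        Across = ∃₂ λ i j → i ≢ j × V (Γ i) x × V (Γ j) y

        across? : Dec Across
        across? = any? λ i → any? λ j → ¬? (i ≟ j) ×-dec (V? (Γ i) x ×-dec V? (Γ j) y)

        to : Across ⊎ Adj (disjointUnion (clique ∘ Γ) disjoint) x y → Adj (completeGraph W W?) x y
        to (inj₁ (i , j , i≢j , p , q)) = (λ { ≡.refl → disjoint i≢j p q }) , (i , p) , (j , q)
        to (inj₂ (i , x≢y , p , q))     = x≢y , (i , p) , (i , q)

        from : Adj (completeGraph W W?) x y → Across ⊎ Adj (disjointUnion (clique ∘ Γ) disjoint) x y
        from (x≢y , (i , p) , (j , q)) with i ≟ j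
        ... | yes ≡.refl = inj₂ (i , x≢y , p , q)
        ... | no i≢j     = inj₁ (i , j , i≢j , p , q)

    -- The terms `u i` have pairwise disjoint supports, and all their swaps permute `W`; inside one
    -- `u i`, the swaps of `Γ i` permute the vertices of its own clique. So every sum taken here is
    -- one of commuting elements.
    splits-join : (∀ i → Splits (t (Γ i))) → Splits (t (join Γ disjoint))
    splits-join splits = splitsOn-cong (sym decompose) refl
      (splitsOn-+
        (sym (commute-∑ (allFin k) λ {i} _ → sym (commute-- (commute-complete (Γ i) W? (i ,_))
                                             (commute-complete (clique (Γ i)) W? (i ,_)))))
        (splits-∑ (allFin k) comm λ i →
          splitsOn-+ (commute-neg (commute-complete (Γ i) (V? (Γ i)) (λ p → p)))
            (splits i) (splitsOn-neg (splits-complete (V? (Γ i)))))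
        (splits-complete W?))
      where
      u : Fin k → Carrier
      u i = t (Γ i) - t (clique (Γ i))

      commute-- : ∀ {x y z} → Commute x z → Commute y z → Commute (x - y) z
      commute-- p q = sym (commute-+ (sym p) (commute-neg (sym q)))

      comm : ∀ i j → Commute (u i) (u j)
      comm i j with i ≟ j
      ... | yes ≡.refl = refl
      ... | no i≢j     = commute-+
        (commute-- (commute-disjoint (Γ i) (Γ j) d) (commute-disjoint (clique (Γ i)) (Γ j) d))
        (commute-neg (commute-- (commute-disjoint (Γ i) (clique (Γ j)) d)
                                (commute-disjoint (clique (Γ i)) (clique (Γ j)) d)))
        where
        d : ∀ {x} → V (Γ i) x → ¬ V (Γ j) x
        d = disjoint i≢j

      decompose : t (join Γ disjoint) ≈ ∑ (allFin k) u + t (completeGraph W W?)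
      decompose = +-cancelʳ (t (disjointUnion (clique ∘ Γ) disjoint)) _ _ (begin
        t (join Γ disjoint) + C                         ≈⟨ t-join ⟩
        t (disjointUnion Γ disjoint) + T                ≈⟨ +-congʳ (t-disjointUnion Γ disjoint) ⟩
        ∑ (allFin k) (λ i → t (Γ i)) + T                ≈⟨ +-congʳ (∑-cong (allFin k) λ _ → sym (cancel _ _)) ⟩
        ∑ (allFin k) (λ i → u i + t (clique (Γ i))) + T ≈⟨ +-congʳ (∑-+ (allFin k) u _) ⟩
        ∑ (allFin k) u + ∑ (allFin k) (λ i → t (clique (Γ i))) + T
          ≈⟨ +-congʳ (+-congˡ (t-disjointUnion (clique ∘ Γ) disjoint)) ⟨
        ∑ (allFin k) u + C + T                          ≈⟨ +-assoc _ _ _ ⟩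
        ∑ (allFin k) u + (C + T)                        ≈⟨ +-congˡ (+-comm C T) ⟩
        ∑ (allFin k) u + (T + C)                        ≈⟨ +-assoc _ _ _ ⟨
        ∑ (allFin k) u + T + C                          ∎)
        where
        C = t (disjointUnion (clique ∘ Γ) disjoint)
        T = t (completeGraph W W?)

        cancel : ∀ x y → x - y + y ≈ x
        cancel x y = trans (+-assoc x _ y) (trans (+-congˡ (-‿inverseˡ y)) (+-identityʳ x))

  splits-completeMultipartite : ∀ G → IsCompleteMultipartite G → Splits (t G)
  splits-completeMultipartite G (r , part , multipartite) =
    splitsOn-cong (t-cong (join parts disjoint) G (to , from)) refl
      (splits-join parts disjoint λ i → splitsOn-cong (sym (∑-zero (pairs (allFin n)) λ _ → refl)) refl splits-0)
    where
    parts : Fin r → FinGraph n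
    parts i = edgelessGraph (λ x → V G x × part x ≡ i) (λ x → V? G x ×-dec part x ≟ i)

    disjoint : PairwiseDisjoint parts
    disjoint i≢j (_ , ≡.refl) (_ , ≡.refl) = i≢j ≡.refl

    to : ∀ {x y} → Adj (join parts disjoint) x y → Adj G x y
    -- The parts are edgeless, so an edge of the join runs between two fibres of `part`.
    to (inj₂ (_ , _ , i≢j , (Gx , ≡.refl) , (Gy , ≡.refl))) = proj₂ (multipartite Gx Gy) i≢j

    from : ∀ {x y} → Adj G x y → Adj (join parts disjoint) x y
    from xy = let Gx = ~⇒V G xy ; Gy = ~⇒V G (~-sym G xy) in
      inj₂ (_ , _ , proj₁ (multipartite Gx Gy) xy , (Gx , ≡.refl) , (Gy , ≡.refl))

  splits-isDisjointUnion : ∀ {p} {P : Pred (FinGraph n) p} → (∀ H → P H → Splits (t H)) →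
                           ∀ G → IsDisjointUnionOf P G → Splits (t G)
  splits-isDisjointUnion splits G union =
    splitsOn-cong (sym (t-cong G (disjointUnion components disjoint) (proj₂ isUnion))) refl
      (splits-disjointUnion components disjoint λ i → splits (components i) (satisfy i))
    where open IsDisjointUnionOf union

  -- `t` sees a graph through its adjacency, which `G` shares with `G ^#`, and `Gs i` with `Γ i` by
  -- `sameEdges`; so `splits-join` for the `Γ i` transfers.
  splits-WJ : ∀ (Gs : Fin k → FinGraph n) {G} → WJ Gs G → (∀ i → Splits (t (Gs i))) → Splits (t G)
  splits-WJ Gs {G} wj splits =
    splitsOn-cong (sym (t-cong G (join Γ disjoint) (proj₂ isJoin))) refl
      (splits-join Γ disjoint λ i → splitsOn-cong (sym (t-cong (Γ i) (Gs i) (sameEdges i))) refl (splits i))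
    where open WJ wj

  -- Components may have any type up to a bound, so the induction runs on the bound `m` instead of
  -- the exact type `l`.
  splits-GCM≤ : ∀ m {l} → l ≤ m → ∀ G → IsGCM l G → Splits (t G)
  splits-GCM≤ m _ G (type-1 Gs wj unions) = splits-WJ Gs wj λ i →
    splits-isDisjointUnion splits-completeMultipartite (Gs i) (unions i)
  splits-GCM≤ (suc m) (s≤s l≤m) G (type-suc _ Gs wj unions) = splits-WJ Gs wj λ i →
    splits-isDisjointUnion (λ { H (l′ , l′≤l , gcm) → splits-GCM≤ m (ℕ.≤-trans l′≤l l≤m) H gcm }) (Gs i) (unions i)

  splits-GCM : ∀ {m} G → IsGCM m G → Splits (t G)
  splits-GCM G = splits-GCM≤ _ ℕ.≤-refl G

-- The regular representation

module LinearOperators {a ℓ} (R : CommutativeRing a ℓ) (X : Set) where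
  open CommutativeRing R hiding (zero)
  open RingProperties ring using (-‿+-comm; -‿distribʳ-*; -‿distribˡ-*)
  open CommutativeSemigroupProperties +-commutativeSemigroup using (interchange)
  open CommutativeSemigroupProperties *-commutativeSemigroup using (x∙yz≈y∙xz)
  open MonoidMult +-monoid using () renaming (_×_ to _·_)
  open ≈-Reasoning setoid

  record Operator : Set (a ⊔ ℓ) where
    field
      ⟦_⟧    : (X → Carrier) → X → Carrier
      ⟦⟧-cong : ∀ {f g} → (∀ x → f x ≈ g x) → ∀ x → ⟦_⟧ f x ≈ ⟦_⟧ g x
      ⟦⟧-+    : ∀ f g x → ⟦_⟧ (λ x → f x + g x) x ≈ ⟦_⟧ f x + ⟦_⟧ g x
      ⟦⟧-*    : ∀ r f x → ⟦_⟧ (λ x → r * f x) x ≈ r * ⟦_⟧ f x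

  open Operator public

  operatorRing : Ring (a ⊔ ℓ) (a ⊔ ℓ)
  operatorRing = record
    { Carrier = Operator
    ; _≈_     = λ e e′ → ∀ f x → ⟦ e ⟧ f x ≈ ⟦ e′ ⟧ f x
    ; _+_     = λ e e′ → record
        { ⟦_⟧     = λ f x → ⟦ e ⟧ f x + ⟦ e′ ⟧ f x
        ; ⟦⟧-cong = λ eq x → +-cong (⟦⟧-cong e eq x) (⟦⟧-cong e′ eq x)
        ; ⟦⟧-+    = λ f g x → trans (+-cong (⟦⟧-+ e f g x) (⟦⟧-+ e′ f g x)) (interchange _ _ _ _)
        ; ⟦⟧-*    = λ r f x → trans (+-cong (⟦⟧-* e r f x) (⟦⟧-* e′ r f x)) (sym (distribˡ r _ _))
        }
    ; _*_     = λ e e′ → record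
        { ⟦_⟧     = λ f → ⟦ e ⟧ (⟦ e′ ⟧ f)
        ; ⟦⟧-cong = λ eq → ⟦⟧-cong e (⟦⟧-cong e′ eq)
        ; ⟦⟧-+    = λ f g x → trans (⟦⟧-cong e (⟦⟧-+ e′ f g) x) (⟦⟧-+ e _ _ x)
        ; ⟦⟧-*    = λ r f x → trans (⟦⟧-cong e (⟦⟧-* e′ r f) x) (⟦⟧-* e r _ x)
        }
    ; -_      = λ e → record
        { ⟦_⟧     = λ f x → - ⟦ e ⟧ f x
        ; ⟦⟧-cong = λ eq x → -‿cong (⟦⟧-cong e eq x)
        ; ⟦⟧-+    = λ f g x → trans (-‿cong (⟦⟧-+ e f g x)) (sym (-‿+-comm _ _))
        ; ⟦⟧-*    = λ r f x → trans (-‿cong (⟦⟧-* e r f x)) (-‿distribʳ-* r _)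
        }
    ; 0#      = record
        { ⟦_⟧     = λ f x → 0#
        ; ⟦⟧-cong = λ eq x → refl
        ; ⟦⟧-+    = λ f g x → sym (+-identityˡ 0#)
        ; ⟦⟧-*    = λ r f x → sym (zeroʳ r)
        }
    ; 1#      = record
        { ⟦_⟧     = id
        ; ⟦⟧-cong = id
        ; ⟦⟧-+    = λ f g x → refl
        ; ⟦⟧-*    = λ r f x → refl
        }
    ; isRing  = record
        { +-isAbelianGroup = record
          { isGroup = record
            { isMonoid = record
              { isSemigroup = record
                { isMagma = record
                  { isEquivalence = record
                    { refl  = λ f x → refl
                    ; sym   = λ p f x → sym (p f x)
                    ; trans = λ p q f x → trans (p f x) (q f x)
                    }
                  ; ∙-cong = λ p q f x → +-cong (p f x) (q f x)
                  }
                ; assoc = λ e e′ e″ f x → +-assoc _ _ _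
                }
              ; identity = (λ e f x → +-identityˡ _) , (λ e f x → +-identityʳ _)
              }
            ; inverse = (λ e f x → -‿inverseˡ _) , (λ e f x → -‿inverseʳ _)
            ; ⁻¹-cong = λ p f x → -‿cong (p f x)
            }
          ; comm = λ e e′ f x → +-comm _ _
          }
        ; *-cong     = λ {_} {e} p q f x → trans (p _ x) (⟦⟧-cong e (q f) x)
        ; *-assoc    = λ e e′ e″ f x → refl
        ; *-identity = (λ e f x → refl) , (λ e f x → refl)
        ; distrib    = (λ e e′ e″ f x → ⟦⟧-+ e _ _ x) , (λ e e′ e″ f x → refl)
        }
    }

  private
    module E = Ring operatorRing
    module Eι = Integers operatorRing
    module Rι = Integers ring

  ⟦⟧-· : ∀ m f x → ⟦ MonoidMult._×_ E.+-monoid m E.1# ⟧ f x ≈ (m · 1#) * f x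
  ⟦⟧-· zero    f x = sym (zeroˡ _)
  ⟦⟧-· (suc m) f x = trans (+-cong (sym (*-identityˡ _)) (⟦⟧-· m f x)) (sym (distribʳ _ _ _))

  ⟦⟧-ι : ∀ z f x → ⟦ Eι.ι z ⟧ f x ≈ Rι.ι z * f x
  ⟦⟧-ι (+ m)    f x = ⟦⟧-· m f x
  ⟦⟧-ι -[1+ m ] f x = trans (-‿cong (⟦⟧-· (suc m) f x)) (-‿distribˡ-* _ _)

  -- A polynomial in `e` acts on an eigenvector as the same polynomial in `μ`. The seeds `e′` and
  -- `r` are general because the recursion of `prod` accumulates the factors in them.
  prod-eigenvector : ∀ {e μ f} → (∀ x → ⟦ e ⟧ f x ≈ μ * f x) →
    ∀ zs {e′ r} → (∀ x → ⟦ e′ ⟧ f x ≈ r * f x) →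
    ∀ x → ⟦ Splitting.prod operatorRing e zs e′ ⟧ f x ≈ Splitting.prod ring μ zs r * f x
  prod-eigenvector                 eigen []                 eq x = eq x
  prod-eigenvector {e} {μ} {f} eigen (z ∷ zs) {e′} {r} eq x =
    prod-eigenvector {e} eigen zs {(e E.- Eι.ι z) E.* e′} (λ x → begin
      ⟦ e E.- Eι.ι z ⟧ (⟦ e′ ⟧ f) x       ≈⟨ ⟦⟧-cong (e E.- Eι.ι z) eq x ⟩
      ⟦ e E.- Eι.ι z ⟧ (λ x → r * f x) x  ≈⟨ ⟦⟧-* (e E.- Eι.ι z) r f x ⟩
      r * (⟦ e ⟧ f x - ⟦ Eι.ι z ⟧ f x)    ≈⟨ *-congˡ (+-cong (eigen x)
                                              (trans (-‿cong (⟦⟧-ι z f x)) (-‿distribˡ-* _ _))) ⟩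
      r * (μ * f x + - Rι.ι z * f x)      ≈⟨ *-congˡ (distribʳ _ _ _) ⟨
      r * ((μ - Rι.ι z) * f x)            ≈⟨ x∙yz≈y∙xz _ _ _ ⟩
      (μ - Rι.ι z) * (r * f x)            ≈⟨ *-assoc _ _ _ ⟨
      (μ - Rι.ι z) * r * f x              ∎) x

-- Left multiplication by transpositions on the enumerated symmetric group.

act : Fin n → Fin n → Fin (n !) → Fin (n !)
act {n} i j r = rank n (unrank n r ∘ₚ transpose i j)

-- `∘ₚ` composes from left to right, so the transposition acts last: `act i j` is left
-- multiplication by it.
unrank-act : ∀ (i j : Fin n) r x → unrank n (act i j r) ⟨$⟩ʳ x ≡ swap i j (unrank n r ⟨$⟩ʳ x)
unrank-act {n} i j r x = unrank-rank n (unrank n r ∘ₚ transpose i j) x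

act-unique : ∀ {i j : Fin n} {r r′} → (∀ x → unrank n r′ ⟨$⟩ʳ x ≡ swap i j (unrank n r ⟨$⟩ʳ x)) →
             r′ ≡ act i j r
act-unique {n} {i} {j} {r} eq = unrank-injective n λ x → ≡.trans (eq x) (≡.sym (unrank-act i j r x))

act-sym : ∀ (i j : Fin n) r → act i j r ≡ act j i r
act-sym i j r = act-unique λ x → ≡.trans (unrank-act i j r x) (swap-comm i j (unrank _ r ⟨$⟩ʳ x))

act-involutive : ∀ (i j : Fin n) r → act i j (act i j r) ≡ r
act-involutive i j r = ≡.sym (act-unique λ x →
  ≡.trans (≡.sym (swap-involutive i j _)) (≡.cong (swap i j) (≡.sym (unrank-act i j r x))))

-- The factors appear in reverse order compared with `s-conj`, because the operators act on
-- functions by composing them with `act` on the inside, which reverses products.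
act-conj : ∀ (a b c d : Fin n) r → act c d (act a b r) ≡ act a b (act (swap a b c) (swap a b d) r)
act-conj {n} a b c d r = act-unique λ x → begin
  unrank n (act c d (act a b r)) ⟨$⟩ʳ x                  ≡⟨ unrank-act c d (act a b r) x ⟩
  swap c d (unrank n (act a b r) ⟨$⟩ʳ x)                 ≡⟨ ≡.cong (swap c d) (unrank-act a b r x) ⟩
  swap c d (swap a b (π x))
    -- `c` and `d` are written as images under `swap a b`, so that `swap-conj` applies from right to
    -- left.
    ≡⟨ ≡.cong₂ (λ c′ d′ → swap c′ d′ (swap a b (π x))) (swap-involutive a b c) (swap-involutive a b d) ⟨
  swap (swap a b (swap a b c)) (swap a b (swap a b d)) (swap a b (π x))
    ≡⟨ swap-conj a b (swap a b c) (swap a b d) (π x) ⟨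
  swap a b (swap (swap a b c) (swap a b d) (π x))        ≡⟨ ≡.cong (swap a b) (unrank-act _ _ r x) ⟨
  swap a b (unrank n (act (swap a b c) (swap a b d) r) ⟨$⟩ʳ x)  ∎
  where
  open ≡.≡-Reasoning
  π = unrank n r ⟨$⟩ʳ_

-- This is `unrank n r` times the inverse of `unrank n q`: the element whose membership in `T`
-- decides adjacency of `r` and `q` in the Cayley graph.
quotient : (q r : Fin (n !)) → Permutation′ n
quotient {n} q r = flip (unrank n q) ∘ₚ unrank n r

quotient⇒act : ∀ {a b : Fin n} {q r} → quotient q r ≈ₚ transpose a b → q ≡ act a b r
quotient⇒act {n} {a} {b} {q} {r} eq = act-unique λ x → begin
  π x                                 ≡⟨ swap-involutive a b (π x) ⟨
  swap a b (swap a b (π x))           ≡⟨ ≡.cong (swap a b) (eq (π x)) ⟨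
  swap a b (unrank n r ⟨$⟩ʳ (unrank n q ⟨$⟩ˡ π x))
    ≡⟨ ≡.cong (λ y → swap a b (unrank n r ⟨$⟩ʳ y)) (inverseˡ (unrank n q)) ⟩
  swap a b (unrank n r ⟨$⟩ʳ x)        ∎
  where
  open ≡.≡-Reasoning
  π = unrank n q ⟨$⟩ʳ_

quotient-act : ∀ (a b : Fin n) r → quotient (act a b r) r ≈ₚ transpose a b
quotient-act {n} a b r x = begin
  unrank n r ⟨$⟩ʳ y                         ≡⟨ swap-involutive a b _ ⟨
  swap a b (swap a b (unrank n r ⟨$⟩ʳ y))   ≡⟨ ≡.cong (swap a b) (unrank-act a b r y) ⟨
  swap a b (unrank n (act a b r) ⟨$⟩ʳ y)    ≡⟨ ≡.cong (swap a b) (inverseʳ (unrank n (act a b r))) ⟩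
  swap a b x                                ∎
  where
  open ≡.≡-Reasoning
  y = unrank n (act a b r) ⟨$⟩ˡ x

-- Evaluated at the preimage `z` of `x`, the hypothesis says that `swap a b` takes `x` to `y`; as
-- `y` differs from `x`, the point `x` must be `a` or `b`.
act-injective : ∀ {a b x y : Fin n} {r} → x ≢ y → act x y r ≡ act a b r →
                (x ≡ a × y ≡ b) ⊎ (x ≡ b × y ≡ a)
act-injective {n} {a} {b} {x} {y} {r} x≢y eq = cases (x ≟ a) (x ≟ b)
  where
  open ≡.≡-Reasoning
  z = unrank n r ⟨$⟩ˡ x

  y≡ : y ≡ swap a b x
  y≡ = begin
    y                                   ≡⟨ swap-left x y ⟨
    swap x y x                          ≡⟨ ≡.cong (swap x y) (inverseʳ (unrank n r)) ⟨
    swap x y (unrank n r ⟨$⟩ʳ z)        ≡⟨ unrank-act x y r z ⟨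
    unrank n (act x y r) ⟨$⟩ʳ z         ≡⟨ ≡.cong (λ q → unrank n q ⟨$⟩ʳ z) eq ⟩
    unrank n (act a b r) ⟨$⟩ʳ z         ≡⟨ unrank-act a b r z ⟩
    swap a b (unrank n r ⟨$⟩ʳ z)        ≡⟨ ≡.cong (swap a b) (inverseʳ (unrank n r)) ⟩
    swap a b x                          ∎

  cases : Dec (x ≡ a) → Dec (x ≡ b) → (x ≡ a × y ≡ b) ⊎ (x ≡ b × y ≡ a)
  cases (yes ≡.refl) _            = inj₁ (≡.refl , ≡.trans y≡ (swap-left x b))
  cases (no _)       (yes ≡.refl) = inj₂ (≡.refl , ≡.trans y≡ (swap-right a x))
  cases (no x≢a)     (no x≢b)     = contradiction (≡.sym (≡.trans y≡ (swap-fixed x≢a x≢b))) x≢y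

-- The adjacency matrix as a sum of transposition operators.

module Regular {a ℓ} (R : CommutativeRing a ℓ) (n : ℕ) where
  open CommutativeRing R hiding (zero)
  open LinearOperators R (Fin (n !))

  transpositionOperators : Transpositions operatorRing n
  transpositionOperators = record
    { s        = λ i j → record
        { ⟦_⟧     = λ f r → f (act i j r)
        ; ⟦⟧-cong = λ eq r → eq (act i j r)
        ; ⟦⟧-+    = λ f g r → refl
        ; ⟦⟧-*    = λ r f x → refl
        }
    ; s-sym    = λ i j f r → reflexive (≡.cong f (act-sym i j r))
    ; s-square = λ i j f r → reflexive (≡.cong f (act-involutive i j r))
    ; s-conj   = λ a b c d f r → reflexive (≡.cong f (act-conj a b c d r))
    }

  open Transpositions transpositionOperators using (s)
  open GraphElements transpositionOperators using (t)
  open Sums ring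
  open CommutativeMonoidSum +-commutativeMonoid using (sum)
  open ≈-Reasoning setoid

  ⟦⟧-∑ : ∀ {A : Set p} (xs : List A) g f r →
         ⟦ Sums.∑ operatorRing xs g ⟧ f r ≈ ∑ xs (λ x → ⟦ g x ⟧ f r)
  ⟦⟧-∑ []       g f r = refl
  ⟦⟧-∑ (x ∷ xs) g f r = +-congˡ (⟦⟧-∑ xs g f r)

  ⟦⟧-when : ∀ {P : Set p} e (P? : Dec P) f r → ⟦ Sums._when_ operatorRing e P? ⟧ f r ≈ ⟦ e ⟧ f r when P?
  ⟦⟧-when e (yes _) f r = refl
  ⟦⟧-when e (no _)  f r = refl

  sum-∑ : ∀ {m} {A : Set p} (g : Fin m → A) (f : A → Carrier) → sum (f ∘ g) ≈ ∑ (tabulate g) f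
  sum-∑ {m = zero}  g f = refl
  sum-∑ {m = suc m} g f = +-congˡ (sum-∑ (g ∘ Fin.suc) f)

  module _ (𝕋 : TranspositionSet n) where
    open TranspositionSet 𝕋
    open Graph (Cay (Sym n) (connectionSet 𝕋)) using (_~_; _~?_)

    private
      G = transpositionGraph 𝕋


    private
      edge? : ∀ r q a b → Dec (T (transpose a b) × q ≡ act a b r)
      edge? r q a b = T? (transpose a b) ×-dec q ≟ act a b r

    -- Neighbours differ by one transposition in `T`, and by `act-injective` only one unordered pair
    -- names it. Thus a matrix entry becomes a sum over the edges of the transposition graph.
    when-edge : ∀ e r q → (e when (unrank n r ~? unrank n q)) ≈
                ∑ (pairs (allFin n)) (λ (a , b) → e when edge? r q a b)
    when-edge e r q with T? (quotient q r)
    ... | no ¬t = sym (∑-zero (pairs (allFin n)) λ { {a , b} _ → when-no e (edge? r q a b)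
            λ { (t , ≡.refl) → ¬t (T-resp (λ x → ≡.sym (quotient-act a b r x)) t) } })
    ... | yes t with a , b , a≢b , eq ← transpositions t =
      sym (trans
        (∑-pairs-single _ f-sym (Unique.allFin⁺ n) a≢b (∈-allFin a) (∈-allFin b)
          λ {x} {y} ¬ab ¬ba → when-no e (edge? r q x y) λ { (txy , q≡) →
            [ ¬ab , ¬ba ]′ (act-injective (λ { ≡.refl → ~-irrefl G txy })
              (≡.trans (≡.sym q≡) (quotient⇒act eq))) })
        (when-yes e (edge? r q a b) (T-resp eq t , quotient⇒act eq)))
      where
      f-sym : ∀ x y → (e when edge? r q x y) ≈ (e when edge? r q y x)
      f-sym x y = when-⇔ e (edge? r q x y) (edge? r q y x) (flip-edge x y) (flip-edge y x)
        where
        flip-edge : ∀ x y → T (transpose x y) × q ≡ act x y r → T (transpose y x) × q ≡ act y x r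
        flip-edge x y (t , q≡) = ~-sym G t , ≡.trans q≡ (act-sym x y r)

    -- After exchanging the sums, each edge `(a , b)` leaves the single column `act a b r`, which is
    -- where `s a b` evaluates `v`.
    matrix-t : ∀ v r →
      sum (λ q → (if does (unrank n r ~? unrank n q) then 1# else 0#) * v q) ≈ ⟦ t G ⟧ v r
    matrix-t v r = begin
      sum (λ q → (1# when (unrank n r ~? unrank n q)) * v q)
        ≈⟨ sum-∑ (id {A = Fin (n !)}) (λ q → (1# when (unrank n r ~? unrank n q)) * v q) ⟩
      ∑ (allFin (n !)) (λ q → (1# when (unrank n r ~? unrank n q)) * v q)
        ≈⟨ ∑-cong (allFin (n !)) (λ {q} _ → trans (when-*ʳ (v q) (unrank n r ~? unrank n q))
             (trans (when-cong (unrank n r ~? unrank n q) (*-identityˡ (v q))) (when-edge (v q) r q))) ⟩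
      ∑ (allFin (n !)) (λ q → ∑ (pairs (allFin n)) (λ (a , b) → v q when edge? r q a b))
        ≈⟨ ∑-comm (allFin (n !)) (pairs (allFin n)) _ ⟩
      ∑ (pairs (allFin n)) (λ (a , b) → ∑ (allFin (n !)) (λ q → v q when edge? r q a b))
        ≈⟨ ∑-cong (pairs (allFin n)) (λ _ → pointwise _ _) ⟩
      ∑ (pairs (allFin n)) (λ (a , b) → ⟦ Sums._when_ operatorRing (s a b) (adj? G a b) ⟧ v r)
        ≈⟨ ⟦⟧-∑ (pairs (allFin n)) _ v r ⟨
      ⟦ t G ⟧ v r ∎
      where
      pointwise : ∀ a b → ∑ (allFin (n !)) (λ q → v q when edge? r q a b) ≈
                  ⟦ Sums._when_ operatorRing (s a b) (adj? G a b) ⟧ v r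
      pointwise a b = begin
        ∑ (allFin (n !)) (λ q → v q when edge? r q a b)
          ≈⟨ ∑-single _ (Unique.allFin⁺ (n !)) (∈-allFin (act a b r))
               (λ {q} q≢ → when-no (v q) (edge? r q a b) (q≢ ∘ proj₂)) ⟩
        (v (act a b r) when edge? r (act a b r) a b)
          ≈⟨ when-⇔ _ (edge? r (act a b r) a b) (adj? G a b) proj₁ (_, ≡.refl) ⟩
        (v (act a b r) when adj? G a b)
          ≈⟨ ⟦⟧-when (s a b) (adj? G a b) v r ⟨
        ⟦ Sums._when_ operatorRing (s a b) (adj? G a b) ⟧ v r ∎

-- Integer eigenvalues in Heyting fields

module HeytingIntegers {a ℓ₁ ℓ₂} (F : HeytingField a ℓ₁ ℓ₂) (char0 : CharacteristicZero F) where
  open HeytingField F hiding (zero)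
  private
    R = HeytingCommutativeRing.commutativeRing heytingCommutativeRing
  open CommutativeRing R using (ring)
  open HeytingProperties heytingCommutativeRing using (1#0; x-0≈x; x#0y#0→xy#0)
  open Integers ring
  open Splitting ring using (prod)
  open ≈-Reasoning setoid

  -- Apartness in a Heyting field is invertibility of the difference, so it depends on the
  -- difference alone.
  #-translate : ∀ {x y u v} → x - y ≈ u - v → x # y → u # v
  #-translate eq x#y with z , zl , zr ← #⇒invertible x#y =
    invertible⇒# (z , trans (*-congˡ (sym eq)) zl , trans (*-congʳ (sym eq)) zr)

  ι#0 : ∀ {z} → z ≢ + 0 → ι z # 0#
  ι#0 {+ zero}   z≢0 = contradiction ≡.refl z≢0
  ι#0 {+ suc m}  _   = char0 m
  ι#0 { -[1+ m ]} _  = #-translate (trans (+-identityˡ _) (sym (x-0≈x _))) (#-sym (char0 m))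

  ι-# : ∀ {z w} → z ≢ w → ι z # ι w
  ι-# {z} {w} z≢w = #-translate
    (trans (x-0≈x _) (trans (ι-+ z (ℤ.- w)) (+-congˡ (ι-neg w))))
    (ι#0 {z ℤ.- w} (z≢w ∘ ℤ.i-j≡0⇒i≡j z w))

  prod-#0 : ∀ {μ} zs → All (λ z → μ # ι z) zs → ∀ {r} → r # 0# → prod μ zs r # 0#
  prod-#0 []       []           r#0 = r#0
  prod-#0 (z ∷ zs) (μ#z ∷ μ#zs) r#0 =
    prod-#0 zs μ#zs (x#0y#0→xy#0 (#-translate (sym (x-0≈x _)) μ#z) r#0)

  -- Two distinct integers are apart, so μ is apart from one of them, which can be dropped.
  root : ∀ {μ} z zs → ¬ All (λ w → μ # ι w) (z ∷ zs) → ∃ λ w → μ ≈ ι w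
  root {μ} z []       h = z , proj₁ (tight μ (ι z)) (λ μ#z → h (μ#z ∷ []))
  root {μ} z (w ∷ zs) h with z ℤ.≟ w
  ... | yes ≡.refl = root w zs λ { (μ#w ∷ μ#zs) → h (μ#w ∷ μ#w ∷ μ#zs) }
  ... | no z≢w with #-cotrans (ι-# z≢w) μ
  ...   | inj₁ z#μ = root w zs λ μ#wzs → h (#-sym z#μ ∷ μ#wzs)
  ...   | inj₂ μ#w = root z zs λ { (μ#z ∷ μ#zs) → h (μ#z ∷ μ#w ∷ μ#zs) }

  -- Were `μ` apart from all the integers in `zs`, the product would be invertible and `v` zero.
  -- That `v` is nonzero is known only as the negation of vanishing everywhere, so what results is
  -- the negative statement that `root` starts from.
  annihilated⇒integer : ∀ {X : Set} {v : X → Carrier} {μ} zs → ¬ (∀ x → v x ≈ 0#) →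
                        (∀ x → prod μ zs 1# * v x ≈ 0#) → ∃ λ z → μ ≈ ι z
  annihilated⇒integer {v = v} {μ} zs v≉0 eq = go zs λ μ#zs → v≉0 (v≈0 (prod-#0 zs μ#zs 1#0))
    where
    v≈0 : prod μ zs 1# # 0# → ∀ x → v x ≈ 0#
    v≈0 P#0 x with y , yP , _ ← #⇒invertible P#0 = begin
      v x                              ≈⟨ *-identityˡ _ ⟨
      1# * v x                         ≈⟨ *-congʳ yP ⟨
      y * (prod μ zs 1# - 0#) * v x    ≈⟨ *-congʳ (*-congˡ (x-0≈x _)) ⟩
      y * prod μ zs 1# * v x           ≈⟨ *-assoc _ _ _ ⟩
      y * (prod μ zs 1# * v x)         ≈⟨ *-congˡ (eq x) ⟩
      y * 0#                           ≈⟨ zeroʳ y ⟩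
      0#                               ∎

    go : ∀ zs → ¬ All (λ z → μ # ι z) zs → ∃ λ z → μ ≈ ι z
    go []       h = contradiction [] h
    go (z ∷ zs) h = root z zs h

  ι≈fromℤ : ∀ z → ι z ≈ fromℤ F z
  ι≈fromℤ (+ m)    = refl
  ι≈fromℤ -[1+ m ] = refl

-- Integrality of the Cayley graph.

proposition3 : (n : ℕ) (𝕋 : TranspositionSet n) (k : ℕ) → 1 ≤ k →
    IsGCM k (transpositionGraph 𝕋) →
    Integral (Cay (Sym n) (connectionSet 𝕋)) (numbering (connectionSet 𝕋))
proposition3 n 𝕋 k _ gcm F char0 μ (v , v≉0 , eigen) =
  proj₁ integer , trans (proj₂ integer) (ι≈fromℤ (proj₁ integer))
  where
  R = HeytingCommutativeRing.commutativeRing (HeytingField.heytingCommutativeRing F)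
  open CommutativeRing R using (_≈_; _*_; trans; sym; *-identityˡ; ring)
  open LinearOperators R (Fin (n !)) using (operatorRing; ⟦_⟧; prod-eigenvector)
  open Regular R n
  open GraphElements transpositionOperators using (t; splits-GCM)
  open HeytingIntegers F char0
  module E = Ring operatorRing
  G = transpositionGraph 𝕋

  eigenvector : ∀ r → ⟦ t G ⟧ v r ≈ μ * v r
  eigenvector r = trans (sym (matrix-t 𝕋 v r)) (eigen r)

  splits : Splitting.Splits operatorRing (t G)
  splits = splits-GCM G gcm

  zs = proj₁ splits

  integer : ∃ λ z → μ ≈ Integers.ι ring z
  integer = annihilated⇒integer zs v≉0 λ r → trans
    -- The seed `E.1#` acts on `v` as the scalar `1#`.
    (sym (prod-eigenvector {t G} eigenvector zs {E.1#} (λ x → sym (*-identityˡ _)) r))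
    (proj₂ splits v r)
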